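{- Let $\mathcal F\in\beta\mathbb N$. If there is a basic class $\mathcal P^u\in\mathcal B$ of the first kind such that $\alpha_{\mathcal F}(\mathcal P^{u+1})>0$ and $\sum_{w\succeq_{\mathcal P}u}\alpha_{\mathcal F}(\mathcal P^w)<\infty$ (i.e. the sum is finite), then $[\mathcal F]$ has an immediate predecessor in the partial order $(\beta\mathbb N/{=_\sim},\widetilde{\mid})$.
   Context: Divisibility of ultrafilters. $\mathbb N=\{1,2,3,\dots\}$, $\mathbb P$ is the set of primes, $\beta\mathbb N$ is the set of ultrafilters on $\mathbb N$, with $n\in\mathbb N$ identified with the principal ultrafilter at $n$. For $A\subseteq\mathbb N$ let $A\uparrow=\{n\in\mathbb N:(\exists a\in A)\,a\mid n\}$, and $\mathcal U=\{A\subseteq\mathbb N: A\ne\emptyset,\ A=A\uparrow\}$. For $\mathcal F,\mathcal G\in\beta\mathbb N$: $\mathcal F\,\widetilde{\mid}\,\mathcal G$ iff $\mathcal F\cap\mathcal U\subseteq\mathcal G$; $\mathcal F=_\sim\mathcal G$ iff $\mathcal F\,\widetilde{\mid}\,\mathcal G$ and $\mathcal G\,\widetilde{\mid}\,\mathcal F$; $[\mathcal F]$ is the $=_\sim$-class of $\mathcal F$, and $\widetilde\mid$ induces a partial order on $\beta\mathbb N/{=_\sim}$. An immediate predecessor of $[\mathcal F]$ is a class $[\mathcal G]\neq[\mathcal F]$ with $\mathcal G\,\widetilde\mid\,\mathcal F$ such that no class lies strictly between $[\mathcal G]$ and $[\mathcal F]$. Nonstandard extension. Standing assumption: we work in a fixed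 nonstandard extension ${}^*$ (of a superstructure over $\mathbb N$) which is $\mathfrak c^+$-saturated and satisfies Henson's isomorphism property (any two elementarily equivalent internally presented structures, for a finite first-order language, are isomorphic). In particular all sets $[1,z]=\{a\in{}^*\mathbb N:a\le z\}$ with $z\in{}^*\mathbb N\setminus\mathbb N$ have the same cardinality, denoted $\infty$. For $x\in{}^*\mathbb N$, $tp(x/\mathbb N)=\{A\subseteq\mathbb N:x\in{}^*A\}\in\beta\mathbb N$; $x\models\mathcal F$ ($x$ is a generator of $\mathcal F$) means $tp(x/\mathbb N)=\mathcal F$. Basic classes. $\overline{\mathbb P}=\{\mathcal P\in\beta\mathbb N:\mathbb P\in\mathcal P\}$. For $\mathcal P\in\overline{\mathbb P}$, on pairs $(p,a)$ with $p\models\mathcal P$, $a\in{}^*\mathbb N$, put $(p,a)\approx_{\mathcal P}(q,b)$ iff $tp(p^a/\mathbb N)=_\sim tp(q^b/\mathbb N)$; $\mathcal E_{\mathcal P}$ is the set of $\approx_{\mathcal P}$-classes. It is linearly ordered by: $u\prec_{\mathcal P}v$ iff $u\ne v$ and for some $p\models\mathcal P$ and $a<b$ in ${}^*\mathbb N$, $(p,a)\in u$ and $(p,b)\in v$; $u\preceq_{\mathcal P}v$ iff $u\prec_{\mathcal P}v$ or $u=v$. For $u\in\mathcal E_{\mathcal P}$ the set $\mathcal P^u=\{tp(p^a/\mathbb N):(p,a)\in u\}$ is called a basic class, and $\mathcal B$ is the set of all basic classes. $p^a\models\mathcal P^u$ means $(p,a)\in u$. For $\mathcal P\in\overline{\mathbb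 P}\setminus\mathbb P$, $\mathcal P^u$ is of the first kind if for every $p\models\mathcal P$ the set $\{a\in{}^*\mathbb N:p^a\models\mathcal P^u\}$ is a singleton; in that case $u$ has an immediate successor in $(\mathcal E_{\mathcal P},\prec_{\mathcal P})$, denoted $u+1$ (if $p^a\models\mathcal P^u$ then $p^{a+1}\models\mathcal P^{u+1}$). Patterns. $\mathbb N_\infty=\{0,1,2,\dots\}\cup\{\infty\}$. For $x\in{}^*\mathbb N$, $p\in{}^*\mathbb P$, $a\in{}^*\mathbb N$, $p^a\,{}^*\!\!\parallel x$ means $x=p^ax'$ with $p$ not dividing $x'$. The pattern of $x$ is $\alpha_x:\mathcal B\to\mathbb N_\infty$, $\alpha_x(\mathcal P^u)=|\{(p,a):p^a\models\mathcal P^u,\ p^a\,{}^*\!\!\parallel x\}|$ (this cardinality is known to lie in $\mathbb N_\infty$). For $\mathcal F\in\beta\mathbb N$, $\alpha_{\mathcal F}:=\alpha_x$ for any $x\models\mathcal F$ (known to be independent of $x$). -}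

module Defs where

open import Level using (0ℓ)
open import Axiom.ExcludedMiddle using (ExcludedMiddle)
open import Data.Bool.Base using (Bool; true; false; T; not; _∧_)
open import Data.Empty using (⊥)
open import Data.Fin.Base using (Fin)
import Data.Nat.Base as ℕ
open ℕ using (ℕ; zero; suc; NonZero)
open import Data.Nat.Divisibility using () renaming (_∣_ to _∣ℕ_)
open import Data.Nat.Primality using (prime?)
open import Data.Product.Base using (Σ-syntax; ∃; _×_; _,_; proj₁; proj₂)
open import Data.Product using (∃!)
open import Data.Refinement using (Refinement; Refinement-syntax; value)
open import Data.Sum.Base using (_⊎_; inj₁; inj₂)
open import Data.List.Base as List using (List)
open import Data.List.Relation.Unary.All using (All)
open import Data.List.Relation.Unary.AllPairs using (AllPairs)
open import Data.Vec.Functional using (Vector; []; _∷_; head; tail; init; last)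
open import Function.Base using (_∘_)
open import Function.Bundles using (Inverse; _⇔_)
open import Function.Definitions using (Congruent; Bijective)
open import Relation.Binary.Bundles using (Setoid)
open import Relation.Binary.Core using (Rel)
import Relation.Binary.Construct.On as On
import Relation.Binary.Construct.Add.Supremum.NonStrict as NonStrict
import Relation.Binary.Construct.Add.Supremum.Strict as Strict
open import Relation.Binary.PropositionalEquality.Core using (_≡_; _≢_)
import Relation.Binary.PropositionalEquality.Properties as ≡
open import Relation.Nullary.Decidable.Core using (⌊_⌋)
open import Relation.Nullary.Negation.Core using (¬_)
open import Relation.Nullary.Construct.Add.Supremum using (_⁺; [_]; ⊤⁺)
open import Relation.Unary using (Pred)

-- The mathematics is classical.  Power sets are Bool-valued predicates, which
-- are all the subsets once excluded middle is assumed; where a set is built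
-- from an undecidable condition, excluded middle is taken as a parameter.

𝒫 : Set → Set
𝒫 A = A → Bool

ℕ⁺ : Set
ℕ⁺ = [ n ∈ ℕ ∣ NonZero n ]

_∣_ : Rel ℕ⁺ 0ℓ
m ∣ n = value m ∣ℕ value n

ℙ : 𝒫 ℕ⁺
ℙ n = ⌊ prime? (value n) ⌋

------------------------------------------------------------------------
-- Superstructures

-- V₀(X) = X and Vₙ₊₁(X) = X ∪ 𝒫(Vₙ(X)), elements of X being atoms.  The same
-- set occurs at many levels, so equality in V(X) = ⋃ₙ Vₙ(X) is the relation
-- _≈_ below: identity of atoms, extensional equality of sets.

Level : Set → ℕ → Set
Level X zero    = X
Level X (suc n) = X ⊎ 𝒫 (Level X n)

V : Set → Set
V X = ∃ (Level X)

atom : {X : Set} → X → V X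
atom x = zero , x

set : {X : Set} → 𝒫 X → V X
set A = 1 , inj₂ A

module _ {X : Set} where

  EqLevel : ∀ m n → Level X m → Level X n → Set
  EqLevel zero    zero    x        y        = x ≡ y
  EqLevel zero    (suc n) x        (inj₁ y) = x ≡ y
  EqLevel zero    (suc n) x        (inj₂ B) = ⊥
  EqLevel (suc m) zero    (inj₁ x) y        = x ≡ y
  EqLevel (suc m) zero    (inj₂ A) y        = ⊥
  EqLevel (suc m) (suc n) (inj₁ x) (inj₁ y) = x ≡ y
  EqLevel (suc m) (suc n) (inj₁ x) (inj₂ B) = ⊥
  EqLevel (suc m) (suc n) (inj₂ A) (inj₁ y) = ⊥
  EqLevel (suc m) (suc n) (inj₂ A) (inj₂ B) =
    (∀ a → T (A a) → ∃ λ b → T (B b) × EqLevel m n a b) ×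
    (∀ b → T (B b) → ∃ λ a → T (A a) × EqLevel m n a b)

  infix 4 _≈_ _∈_

  _≈_ : Rel (V X) 0ℓ
  (m , a) ≈ (n , b) = EqLevel m n a b

  _∈_ : Rel (V X) 0ℓ
  v ∈ (zero  , x)      = ⊥
  v ∈ (suc n , inj₁ x) = ⊥
  v ∈ (suc n , inj₂ B) = ∃ λ b → T (B b) × v ≈ (n , b)

  -- s = {v , w}
  IsUnorderedPair : V X → V X → V X → Set
  IsUnorderedPair s v w = ∀ t → t ∈ s ⇔ (t ≈ v ⊎ t ≈ w)

  -- z = {{v} , {v , w}}
  IsPair : V X → V X → V X → Set
  IsPair z v w = ∀ s → s ∈ z ⇔ (IsUnorderedPair s v v ⊎ IsUnorderedPair s v w)

  -- (v₀ , (v₁ , … (vₖ₋₁ , vₖ)…)), a 1-tuple being its only entry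
  IsTuple : ∀ {k} → V X → Vector (V X) (suc k) → Set
  IsTuple {zero}  z vs = z ≈ head vs
  IsTuple {suc k} z vs = ∃ λ s → IsTuple s (tail vs) × IsPair z (head vs) s

-- A (k+1)-ary relation as an element of V(X); tuples of atoms occur at
-- level 2k.
relation : ExcludedMiddle 0ℓ → {X : Set} (k : ℕ) →
           Pred (Vector X (suc k)) 0ℓ → V X
relation lem k R =
  suc (2 ℕ.* k) ,
  inj₂ λ v → ⌊ lem {∃ λ xs → IsTuple (2 ℕ.* k , v) (atom ∘ xs) × R xs} ⌋

------------------------------------------------------------------------
-- Nonstandard extensions

-- Bounded-quantifier formulas in ∈ and =, with de Bruijn variables

infix 6 _≐_ _∊_

data Δ₀ (n : ℕ) : Set where
  _≐_ _∊_        : Fin n → Fin n → Δ₀ n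
  neg            : Δ₀ n → Δ₀ n
  conj disj impl : Δ₀ n → Δ₀ n → Δ₀ n
  all∈ ex∈       : Fin n → Δ₀ (suc n) → Δ₀ n

infix 3 _⊨Δ₀_

_⊨Δ₀_ : {X : Set} {n : ℕ} → Vector (V X) n → Δ₀ n → Set
ρ ⊨Δ₀ (i ≐ j)    = ρ i ≈ ρ j
ρ ⊨Δ₀ (i ∊ j)    = ρ i ∈ ρ j
ρ ⊨Δ₀ (neg φ)    = ¬ (ρ ⊨Δ₀ φ)
ρ ⊨Δ₀ (conj φ ψ) = (ρ ⊨Δ₀ φ) × (ρ ⊨Δ₀ ψ)
ρ ⊨Δ₀ (disj φ ψ) = (ρ ⊨Δ₀ φ) ⊎ (ρ ⊨Δ₀ ψ)
ρ ⊨Δ₀ (impl φ ψ) = (ρ ⊨Δ₀ φ) → (ρ ⊨Δ₀ ψ)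
ρ ⊨Δ₀ (all∈ i φ) = ∀ v → v ∈ ρ i → v ∷ ρ ⊨Δ₀ φ
ρ ⊨Δ₀ (ex∈ i φ)  = ∃ λ v → v ∈ ρ i × (v ∷ ρ ⊨Δ₀ φ)

record NonstandardExtension : Set₁ where
  field
    *ℕ       : Set
    ι        : ℕ⁺ → *ℕ
    *_       : V ℕ⁺ → V *ℕ
    *-atom   : ∀ n → * (atom n) ≈ atom (ι n)
    *-ℕ      : * (set λ _ → true) ≈ set λ _ → true
    transfer : ∀ {n} (φ : Δ₀ n) (ρ : Vector (V ℕ⁺) n) →
               (ρ ⊨Δ₀ φ) ⇔ (*_ ∘ ρ ⊨Δ₀ φ)

  Internal : V *ℕ → Set
  Internal v = ∃ λ A → v ∈ * A

-- The (nonempty) families of at most 𝔠 sets are those indexed, possibly with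
-- repetitions, by ℕ → Bool.
𝔠⁺-Saturated : NonstandardExtension → Set
𝔠⁺-Saturated 𝔑 =
  (S : (ℕ → Bool) → V *ℕ) → (∀ i → Internal (S i)) →
  (∀ (is : List (ℕ → Bool)) → ∃ λ v → All (λ i → v ∈ S i) is) →
  ∃ λ v → ∀ i → v ∈ S i
  where open NonstandardExtension 𝔑

------------------------------------------------------------------------
-- Finite first-order languages and Henson's isomorphism property

record Language : Set where
  field
    #fun     : ℕ
    funArity : Fin #fun → ℕ
    #rel     : ℕ
    relArity : Fin #rel → ℕ  -- a symbol R has suc (relArity R) arguments

module _ (L : Language) where
  open Language L

  data Term (n : ℕ) : Set where
    var : Fin n → Term n
    app : (f : Fin #fun) → Vector (Term n) (funArity f) → Term n

  data Formula (n : ℕ) : Set where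
    eq             : Term n → Term n → Formula n
    pred           : (R : Fin #rel) → Vector (Term n) (suc (relArity R)) → Formula n
    neg            : Formula n → Formula n
    conj disj impl : Formula n → Formula n → Formula n
    all ex         : Formula (suc n) → Formula n

module _ (𝔑 : NonstandardExtension) where
  open NonstandardExtension 𝔑

  Elem : V *ℕ → Set
  Elem D = ∃ (_∈ D)

  infix 4 _≈ₑ_

  _≈ₑ_ : {D E : V *ℕ} → Elem D → Elem E → Set
  x ≈ₑ y = proj₁ x ≈ proj₁ y

  -- The domain, the graph of each function and each relation are internal.
  record InternallyPresented (L : Language) : Set where
    open Language L
    field
      domain          : V *ℕ
      domain-internal : Internal domain
      nonempty        : Elem domain
      fun             : ∀ f → Vector (Elem domain) (funArity f) → Elem domain
      fun-cong        : ∀ f xs ys → (∀ i → xs i ≈ₑ ys i) →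
                        fun f xs ≈ₑ fun f ys
      graph           : Fin #fun → V *ℕ
      graph-internal  : ∀ f → Internal (graph f)
      graph-spec      : ∀ f z → z ∈ graph f ⇔
                        (∃ λ xs → IsTuple z (proj₁ ∘ xs) ×
                                  fun f (init xs) ≈ₑ last xs)
      rel             : Fin #rel → V *ℕ
      rel-internal    : ∀ R → Internal (rel R)
      rel-set         : ∀ R x → ¬ (rel R ≈ atom x)
      rel-domain      : ∀ R z → z ∈ rel R →
                        ∃ λ (xs : Vector (Elem domain) (suc (relArity R))) →
                          IsTuple z (proj₁ ∘ xs)

    Rel[_] : ∀ R → Pred (Vector (Elem domain) (suc (relArity R))) 0ℓ
    Rel[ R ] xs = ∃ λ z → IsTuple z (proj₁ ∘ xs) × z ∈ rel R

    ⟦_⟧ : ∀ {n} → Term L n → Vector (Elem domain) n → Elem domain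
    ⟦ var i ⟧    ρ = ρ i
    ⟦ app f ts ⟧ ρ = fun f λ i → ⟦ ts i ⟧ ρ

    Sat : ∀ {n} → Vector (Elem domain) n → Formula L n → Set
    Sat ρ (eq s t)   = ⟦ s ⟧ ρ ≈ₑ ⟦ t ⟧ ρ
    Sat ρ (pred R ts) = Rel[ R ] λ i → ⟦ ts i ⟧ ρ
    Sat ρ (neg φ)    = ¬ Sat ρ φ
    Sat ρ (conj φ ψ) = Sat ρ φ × Sat ρ ψ
    Sat ρ (disj φ ψ) = Sat ρ φ ⊎ Sat ρ ψ
    Sat ρ (impl φ ψ) = Sat ρ φ → Sat ρ ψ
    Sat ρ (all φ)    = ∀ x → Sat (x ∷ ρ) φ
    Sat ρ (ex φ)     = ∃ λ x → Sat (x ∷ ρ) φ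

  module _ {L : Language} (𝔄 𝔅 : InternallyPresented L) where
    open Language L
    private
      module A = InternallyPresented 𝔄
      module B = InternallyPresented 𝔅

    ElementarilyEquivalent : Set
    ElementarilyEquivalent = ∀ (φ : Formula L 0) → A.Sat [] φ ⇔ B.Sat [] φ

    record Isomorphism : Set where
      field
        to        : Elem A.domain → Elem B.domain
        congruent : Congruent (_≈ₑ_ {A.domain}) (_≈ₑ_ {B.domain}) to
        bijective : Bijective (_≈ₑ_ {A.domain}) (_≈ₑ_ {B.domain}) to
        pres-fun  : ∀ f xs → to (A.fun f xs) ≈ₑ B.fun f (to ∘ xs)
        pres-rel  : ∀ R xs → A.Rel[ R ] xs ⇔ B.Rel[ R ] (to ∘ xs)

  IsomorphismProperty : Set
  IsomorphismProperty =
    (L : Language) (𝔄 𝔅 : InternallyPresented L) →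
    ElementarilyEquivalent 𝔄 𝔅 → Isomorphism 𝔄 𝔅

------------------------------------------------------------------------
-- Ultrafilters on ℕ⁺ and their divisibility

record βℕ : Set where
  field
    family   : 𝒫 (𝒫 ℕ⁺)
    ∅-∉      : ¬ T (family λ _ → false)
    ∩-closed : ∀ A B → T (family A) → T (family B) → T (family λ n → A n ∧ B n)
    ↑-closed : ∀ A B → (∀ n → T (A n) → T (B n)) → T (family A) → T (family B)
    ultra    : ∀ A → T (family A) ⊎ T (family (not ∘ A))

open βℕ public using (family)

infix 8 _↑

_↑ : 𝒫 ℕ⁺ → Pred ℕ⁺ 0ℓ
(A ↑) n = ∃ λ a → T (A a) × a ∣ n

𝒰 : Pred (𝒫 ℕ⁺) 0ℓ
𝒰 A = (∃ λ n → T (A n)) × (∀ n → T (A n) ⇔ (A ↑) n)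

-- Divisibility is defined for arbitrary families of sets, so that it applies
-- to types of nonstandard numbers directly.

infix 4 _∣̃_ _=∼_ _<∼_

_∣̃_ _=∼_ _<∼_ : Rel (𝒫 (𝒫 ℕ⁺)) 0ℓ
F ∣̃ G = ∀ A → T (F A) → 𝒰 A → T (G A)
F =∼ G = F ∣̃ G × G ∣̃ F
F <∼ G = F ∣̃ G × ¬ (F =∼ G)

ImmediatePredecessor : {A : Set} → Rel A 0ℓ → Rel A 0ℓ
ImmediatePredecessor _<_ x y = x < y × (∀ z → ¬ (x < z × z < y))

HasImmediatePredecessor : βℕ → Set
HasImmediatePredecessor F =
  ∃ λ G → ImmediatePredecessor (λ H K → family H <∼ family K) G F

------------------------------------------------------------------------
-- ℕ∞ = {0,1,2,…} ∪ {∞}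

ℕ∞ : Set
ℕ∞ = ℕ ⁺

open NonStrict ℕ._≤_ public using () renaming (_≤⁺_ to _≤∞_)
open Strict ℕ._<_ public using () renaming (_<⁺_ to _<∞_)

_+∞_ : ℕ∞ → ℕ∞ → ℕ∞
[ m ] +∞ [ n ] = [ m ℕ.+ n ]
[ m ] +∞ ⊤⁺    = ⊤⁺
⊤⁺    +∞ y     = ⊤⁺

module _ {A : Set} (_~_ : Rel A 0ℓ) (Q : Pred A 0ℓ) (f : A → ℕ∞) where

  FiniteSum : Pred ℕ∞ 0ℓ
  FiniteSum s = ∃ λ xs → All Q xs × AllPairs (λ x y → ¬ (x ~ y)) xs ×
                         s ≡ List.foldr _+∞_ [ 0 ] (List.map f xs)

  -- s is the sum of f over the _~_-classes of elements satisfying Q, that is,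
  -- the supremum of the finite partial sums.
  IsSum : Pred ℕ∞ 0ℓ
  IsSum s = (∀ t → FiniteSum t → t ≤∞ s) ×
            (∀ b → (∀ t → FiniteSum t → t ≤∞ b) → s ≤∞ b)

-- Elements of a subset count as equal when they are equal in A.
subset : {A : Set} → Pred A 0ℓ → Setoid 0ℓ 0ℓ
subset {A} S = On.setoid (≡.setoid A) (proj₁ {B = S})

------------------------------------------------------------------------
-- Types, basic classes and patterns

module Nonstandard (lem : ExcludedMiddle 0ℓ) (𝔑 : NonstandardExtension) where
  open NonstandardExtension 𝔑

  *Rel : ∀ {k} → Pred (Vector ℕ⁺ (suc k)) 0ℓ → Pred (Vector *ℕ (suc k)) 0ℓ
  *Rel {k} R xs = ∃ λ z → IsTuple z (atom ∘ xs) × z ∈ * relation lem k R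

  module _ where
    open Data.Fin.Base.Fin

    _·_≐*_ _^_≐*_ : *ℕ → *ℕ → *ℕ → Set
    x · y ≐* z =
      *Rel (λ v → value (v zero) ℕ.* value (v (suc zero)) ≡ value (v (suc (suc zero))))
           (x ∷ y ∷ z ∷ [])
    x ^ y ≐* z =
      *Rel (λ v → value (v zero) ℕ.^ value (v (suc zero)) ≡ value (v (suc (suc zero))))
           (x ∷ y ∷ z ∷ [])

    _≤*_ _<*_ _∣*_ : Rel *ℕ 0ℓ
    x ≤* y = *Rel (λ v → value (v zero) ℕ.≤ value (v (suc zero))) (x ∷ y ∷ [])
    x <* y = *Rel (λ v → value (v zero) ℕ.< value (v (suc zero))) (x ∷ y ∷ [])
    x ∣* y = *Rel (λ v → v zero ∣ v (suc zero)) (x ∷ y ∷ [])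

  tp : *ℕ → 𝒫 (𝒫 ℕ⁺)
  tp x A = ⌊ lem {atom x ∈ * set A} ⌋

  infix 4 _⊨_

  _⊨_ : *ℕ → βℕ → Set
  x ⊨ F = ∀ A → tp x A ≡ family F A

  -- |S| = c, where ∞ is the common cardinality of the sets [1,z] with z
  -- nonstandard.
  HasCardinality : {A : Set} → Pred A 0ℓ → ℕ∞ → Set
  HasCardinality S [ n ] = Inverse (subset S) (≡.setoid (Fin n))
  HasCardinality S ⊤⁺    =
    ∀ z → (∀ n → z ≢ ι n) → Inverse (subset S) (subset (_≤* z))

  record P̄ : Set where
    field
      ultrafilter : βℕ
      ℙ-∈         : T (family ultrafilter ℙ)

  open P̄ public using (ultrafilter)

  Principal : Pred P̄ 0ℓ
  Principal P = ∃ λ n → ∀ A → family (ultrafilter P) A ≡ A n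

  -- Elements of 𝓔 P are given by representatives and compared by _≈ᴱ_.
  record 𝓔 (P : P̄) : Set where
    constructor ⟨_,_,_⟩
    field
      p   : *ℕ
      p⊨P : p ⊨ ultrafilter P
      a   : *ℕ

  module _ {P : P̄} where

    infix 4 _≈ᴱ_ _≺_ _≼_

    _≈ᴱ_ : Rel (𝓔 P) 0ℓ
    ⟨ p , _ , a ⟩ ≈ᴱ ⟨ q , _ , b ⟩ =
      ∃ λ y → ∃ λ z → p ^ a ≐* y × q ^ b ≐* z × tp y =∼ tp z

    _∈ᴱ_ : *ℕ × *ℕ → 𝓔 P → Set
    (p , a) ∈ᴱ u = Σ[ p⊨P ∈ p ⊨ ultrafilter P ] ⟨ p , p⊨P , a ⟩ ≈ᴱ u

    _≺_ _≼_ : Rel (𝓔 P) 0ℓ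
    u ≺ v = ¬ (u ≈ᴱ v) ×
            ∃ λ p → ∃ λ a → ∃ λ b →
              p ⊨ ultrafilter P × a <* b × (p , a) ∈ᴱ u × (p , b) ∈ᴱ v
    u ≼ v = u ≺ v ⊎ u ≈ᴱ v

    FirstKind : Pred (𝓔 P) 0ℓ
    FirstKind u = ¬ Principal P ×
                  (∀ p → p ⊨ ultrafilter P → ∃! _≡_ λ a → (p , a) ∈ᴱ u)

    -- v = u + 1
    ImmediateSuccessor : Rel (𝓔 P) 0ℓ
    ImmediateSuccessor u v = ImmediatePredecessor _≺_ u v

  -- The basic class Pᵘ is given by the pair (P , u).
  𝓑 : Set
  𝓑 = ∃ 𝓔

  -- pᵃ *∥ x
  ExactlyDivides : *ℕ → *ℕ → *ℕ → Set
  ExactlyDivides p a x =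
    ∃ λ y → ∃ λ x′ → p ^ a ≐* y × y · x′ ≐* x × ¬ (p ∣* x′)

  IsPatternOf : *ℕ → (𝓑 → ℕ∞) → Set
  IsPatternOf x α = ∀ ((P , u) : 𝓑) →
    HasCardinality (λ ((p , a) : *ℕ × *ℕ) → (p , a) ∈ᴱ u × ExactlyDivides p a x) (α (P , u))

  -- α = α_F
  IsPattern : βℕ → (𝓑 → ℕ∞) → Set
  IsPattern F α = ∃ λ x → x ⊨ F × IsPatternOf x α

{-# OPTIONS --safe #-}

-- Let x ⊨ F.  The hypotheses provide a prime p ⊨ P and an exponent a with
-- pᵃ⁺¹ exactly dividing x, pᵃ ⊨ Pᵘ and pᵃ⁺¹ ⊨ Pᵘ⁺¹, and an upward closed A with
-- pᵃ⁺¹ ∈ *A and pᵃ ∉ *A.  A prime q ⊨ P for which qᵉ divides x and qᵉ⁺¹ ∈ *A has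
-- its exact power in a class above u, so the sum bounds the number of such q.  By
-- saturation the same bound holds for all q ∈ *C, for a suitable C ∈ P.  Hence the
-- set T(x) of these q ∈ *C is finite, and p is its i-th element for some
-- standard i.  Let g(n) be n divided by the i-th element of T(n), and let G be the
-- image of F under g.  Dividing by that prime lowers its exponent from the
-- threshold set by A but leaves T(n) unchanged, whence G < F.  If G ≤ H ≤ F, then
-- H contains a set of z with g(m) ∣ z ∣ n, where T(g(m)) = T(z) = T(n) and so the
-- same prime q is divided out of m and of n.  Either the exponent of q in z is
-- below the threshold and z ∣ g(n), or it is not and m = g(m) q ∣ z.  So H cannot
-- be separated from both G and F.

module Submission where

open import Level using (0ℓ)
open import Axiom.ExcludedMiddle using (ExcludedMiddle)
open import Axiom.Extensionality.Propositional using (Extensionality)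
open import Data.Bool.Base using (Bool; true; false; T; not; _∧_; if_then_else_)
open import Data.Bool.Properties using (T-∧; T-not-≡)
open import Data.Empty using (⊥; ⊥-elim)
open import Data.Empty.Irrelevant using () renaming (⊥-elim to ⊥-elim-irr)
open import Data.Fin.Base using (Fin; zero; suc; _↑ˡ_; _↑ʳ_)
open import Data.Fin.Patterns
import Data.Fin.Properties as Fin
open import Data.Irrelevant using () renaming ([_] to irr)
open import Data.List.Base as List using (List)
open import Data.List.Membership.Propositional using () renaming (_∈_ to _∈ₗ_)
open import Data.List.Membership.Propositional.Properties using (∈-++⁺ˡ; ∈-++⁺ʳ; ∈-tabulate⁺)
open import Data.List.Properties using (length-++; length-tabulate)
open import Data.List.Relation.Unary.All as All using (All)
open import Data.List.Relation.Unary.All.Properties.Core using (¬Any⇒All¬)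
open import Data.List.Relation.Unary.AllPairs as AllPairs using (AllPairs)
open import Data.List.Relation.Unary.Any as Any using (Any; here; there)
open import Data.List.Relation.Unary.Any.Properties using (lookup-index)
import Data.Nat.Base as ℕ
open ℕ using (ℕ; zero; suc; NonZero; z≤n; s≤s; _≤′_; ≤′-refl; ≤′-step)
import Data.Nat.Divisibility as ∣
open import Data.Nat.Primality using (Prime; euclidsLemma; prime⇒irreducible; prime⇒nonTrivial; prime⇒nonZero)
import Data.Nat.Properties as ℕ
open import Data.Product using (∃!)
open import Data.Product.Base using (∃; _×_; _,_; proj₁; proj₂)
open import Data.Refinement using (value; _,_)
open import Data.Refinement.Properties using (value-injective)
open import Data.Sum.Base using (_⊎_; inj₁; inj₂)
open import Data.Unit.Base using (tt)
open import Data.Vec.Functional using (Vector; []; _∷_; head; tail; _++_)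
open import Data.Vec.Functional.Properties using (lookup-++ˡ; lookup-++ʳ)
open import Function.Base using (_∘_; id)
open import Function.Bundles using (_⇔_; mk⇔; Equivalence; Inverse)
import Function.Properties.Equivalence as ⇔
import Relation.Binary.Construct.Add.Supremum.NonStrict as NonStrict
import Relation.Binary.Construct.Add.Supremum.Strict as Strict
open import Relation.Binary.Core using (Rel)
open import Relation.Binary.Definitions using (tri<; tri≈; tri>)
open import Relation.Binary.PropositionalEquality
  using (_≡_; _≢_; refl; sym; trans; cong; cong₂; subst; subst₂)
open import Relation.Nullary.Construct.Add.Supremum using ([_]; ⊤⁺)
open import Relation.Nullary.Decidable.Core using (⌊_⌋; toWitness; fromWitness; yes; no)
open import Relation.Nullary.Negation.Core using (¬_)
open import Relation.Unary using (Pred)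
open import Defs

open Equivalence using (to; from)

-- Superstructures

-- The generators of `P` form an external set, so neither the bound given by the sum nor the choice
-- of a prime transfers directly. This is why a standard set C in `P` takes their place: if the
-- layer of every C had more than K members at x, saturation would produce K + 1 distinct
-- generators, each with an exact power in a class from u upwards.
--
-- The first kind enters through the uniqueness of exponents: a power pᵃ⁺¹ equivalent to pᵃ would
-- give p a second exponent in u, and every other generator q has an exponent of its own in u with
-- which its power in x can be compared.
--
-- T(n) has to survive the division by its i-th element, since otherwise that element need not be
-- the same prime for n and for g(n). Hence the condition qᵉ⁺¹ ∈ A where qᵉ divides n, with a slack
-- of one exponent. As T(n) has at most K elements for F-almost all n, its size and the index i are
-- constant on a set in F, and equal sizes turn an inclusion of such sets into equality.

module _ {X : Set} where

  EqLevel-refl : ∀ m a → EqLevel {X} m m a a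
  EqLevel-refl zero    a        = refl
  EqLevel-refl (suc m) (inj₁ x) = refl
  EqLevel-refl (suc m) (inj₂ A) =
    (λ a Aa → a , Aa , EqLevel-refl m a) , (λ a Aa → a , Aa , EqLevel-refl m a)

  EqLevel-sym : ∀ m n a b → EqLevel {X} m n a b → EqLevel {X} n m b a
  EqLevel-sym zero    zero    a        b        e = sym e
  EqLevel-sym zero    (suc n) a        (inj₁ y) e = sym e
  EqLevel-sym (suc m) zero    (inj₁ x) b        e = sym e
  EqLevel-sym (suc m) (suc n) (inj₁ x) (inj₁ y) e = sym e
  EqLevel-sym (suc m) (suc n) (inj₂ A) (inj₂ B) (f , g) =
    (λ b Bb → let a , Aa , e = g b Bb in a , Aa , EqLevel-sym m n a b e) ,
    (λ a Aa → let b , Bb , e = f a Aa in b , Bb , EqLevel-sym m n a b e)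

  EqLevel-trans : ∀ m n o a b c →
    EqLevel {X} m n a b → EqLevel {X} n o b c → EqLevel {X} m o a c
  EqLevel-trans zero    zero    zero    a        b        c        d e = trans d e
  EqLevel-trans zero    zero    (suc o) a        b        (inj₁ z) d e = trans d e
  EqLevel-trans zero    (suc n) zero    a        (inj₁ y) c        d e = trans d e
  EqLevel-trans zero    (suc n) (suc o) a        (inj₁ y) (inj₁ z) d e = trans d e
  EqLevel-trans (suc m) zero    zero    (inj₁ x) b        c        d e = trans d e
  EqLevel-trans (suc m) zero    (suc o) (inj₁ x) b        (inj₁ z) d e = trans d e
  EqLevel-trans (suc m) (suc n) zero    (inj₁ x) (inj₁ y) c        d e = trans d e
  EqLevel-trans (suc m) (suc n) (suc o) (inj₁ x) (inj₁ y) (inj₁ z) d e = trans d e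
  EqLevel-trans (suc m) (suc n) (suc o) (inj₂ A) (inj₂ B) (inj₂ C) (f , g) (h , k) =
    (λ a Aa → let b , Bb , d = f a Aa
                  c , Cc , e = h b Bb
              in c , Cc , EqLevel-trans m n o a b c d e) ,
    (λ c Cc → let b , Bb , e = k c Cc
                  a , Aa , d = g b Bb
              in a , Aa , EqLevel-trans m n o a b c d e)

  ≈-refl : {v : V X} → v ≈ v
  ≈-refl {m , a} = EqLevel-refl m a

  ≈-sym : {v w : V X} → v ≈ w → w ≈ v
  ≈-sym {m , a} {n , b} = EqLevel-sym m n a b

  ≈-trans : {u v w : V X} → u ≈ v → v ≈ w → u ≈ w
  ≈-trans {m , a} {n , b} {o , c} = EqLevel-trans m n o a b c

  ∈-respˡ : {v w s : V X} → v ≈ w → w ∈ s → v ∈ s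
  ∈-respˡ {v} {w} {suc n , inj₂ B} e (b , Bb , d) = b , Bb , ≈-trans {v} {w} e d

  ∈-respʳ : {v s t : V X} → s ≈ t → v ∈ s → v ∈ t
  ∈-respʳ {v} {suc m , inj₂ A} {suc n , inj₂ B} (f , _) (a , Aa , d) =
    let b , Bb , e = f a Aa in b , Bb , ≈-trans {v} {m , a} {n , b} d e

  -- Atoms and the empty set have the same members, namely none, so extensionality needs a member on
  -- one side.
  ∈-ext : {s t : V X} → ∃ (_∈ s) → (∀ v → v ∈ s ⇔ v ∈ t) → s ≈ t
  ∈-ext {suc m , inj₂ A} {zero , y}       (v , v∈s) h = to (h v) v∈s
  ∈-ext {suc m , inj₂ A} {suc n , inj₁ y} (v , v∈s) h = to (h v) v∈s
  ∈-ext {suc m , inj₂ A} {suc n , inj₂ B} _         h =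
    (λ a Aa → to (h (m , a)) (a , Aa , ≈-refl {m , a})) ,
    (λ b Bb → let a , Aa , e = from (h (n , b)) (b , Bb , ≈-refl {n , b})
              in a , Aa , ≈-sym {n , b} {m , a} e)

  UnorderedPair-unique : ∀ {s t v w : V X} →
    IsUnorderedPair s v w → IsUnorderedPair t v w → s ≈ t
  UnorderedPair-unique {v = v} h k = ∈-ext (v , from (h v) (inj₁ (≈-refl {v})))
    λ x → mk⇔ (λ x∈s → from (k x) (to (h x) x∈s)) (λ x∈t → from (h x) (to (k x) x∈t))

  ⊎-≈-resp : ∀ {t v w v′ w′ : V X} → v ≈ v′ → w ≈ w′ → t ≈ v ⊎ t ≈ w → t ≈ v′ ⊎ t ≈ w′
  ⊎-≈-resp {t} {v} {w} d e (inj₁ f) = inj₁ (≈-trans {t} {v} f d)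
  ⊎-≈-resp {t} {v} {w} d e (inj₂ f) = inj₂ (≈-trans {t} {w} f e)

  UnorderedPair-resp : ∀ {s t v w v′ w′ : V X} → s ≈ t → v ≈ v′ → w ≈ w′ →
    IsUnorderedPair s v w → IsUnorderedPair t v′ w′
  UnorderedPair-resp {s} {t} {v} {w} {v′} {w′} c d e h x = mk⇔
    (λ x∈t → ⊎-≈-resp {x} {v} {w} d e (to (h x) (∈-respʳ {x} {t} {s} (≈-sym {s} {t} c) x∈t)))
    (λ i → ∈-respʳ {x} {s} {t} c
      (from (h x) (⊎-≈-resp {x} {v′} {w′} (≈-sym {v} d) (≈-sym {w} e) i)))

  Pair-resp : ∀ {z z′ v w v′ w′ : V X} → z ≈ z′ → v ≈ v′ → w ≈ w′ → IsPair z v w → IsPair z′ v′ w′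
  Pair-resp {z} {z′} {v} {w} {v′} {w′} c d e h s = mk⇔
    (λ s∈z′ → fwd (to (h s) (∈-respʳ {s} {z′} {z} (≈-sym {z} c) s∈z′)))
    (λ i → ∈-respʳ {s} {z} {z′} c (from (h s) (bwd i)))
    where
    fwd : IsUnorderedPair s v v ⊎ IsUnorderedPair s v w →
          IsUnorderedPair s v′ v′ ⊎ IsUnorderedPair s v′ w′
    fwd (inj₁ i) = inj₁ (UnorderedPair-resp {s} {s} {v} {v} (≈-refl {s}) d d i)
    fwd (inj₂ i) = inj₂ (UnorderedPair-resp {s} {s} {v} {w} (≈-refl {s}) d e i)
    bwd : IsUnorderedPair s v′ v′ ⊎ IsUnorderedPair s v′ w′ →
          IsUnorderedPair s v v ⊎ IsUnorderedPair s v w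
    bwd (inj₁ i) = inj₁ (UnorderedPair-resp {s} {s} {v′} {v′} (≈-refl {s}) (≈-sym {v} d) (≈-sym {v} d) i)
    bwd (inj₂ i) = inj₂ (UnorderedPair-resp {s} {s} {v′} {w′} (≈-refl {s}) (≈-sym {v} d) (≈-sym {w} e) i)

  Tuple-resp : ∀ {k} {z z′ : V X} {vs ws : Vector (V X) (suc k)} →
    z ≈ z′ → (∀ i → vs i ≈ ws i) → IsTuple z vs → IsTuple z′ ws
  Tuple-resp {zero} {z} {z′} {vs} {ws} c d e =
    ≈-trans {z′} {z} (≈-sym {z} c) (≈-trans {z} {vs zero} e (d zero))
  Tuple-resp {suc k} {z} {z′} {vs} {ws} c d (s , t , p) =
    s , Tuple-resp {k} {s} {s} (≈-refl {s}) (d ∘ suc) t ,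
    Pair-resp {z} {z′} {vs zero} {s} c (d zero) (≈-refl {s}) p

module _ (lem : ExcludedMiddle 0ℓ) {X : Set} where

  -- The members of a set all come from one level, so a pair can be formed only after its entries
  -- have been copied to a common level. The copy of a set collects everything equal to one of its
  -- members.
  lift : ∀ n → Level X n → Level X (suc n)
  lift zero    x        = inj₁ x
  lift (suc n) (inj₁ x) = inj₁ x
  lift (suc n) (inj₂ A) = inj₂ λ c → ⌊ lem {∃ λ a → T (A a) × EqLevel (suc n) n c a} ⌋

  lift-≈ : ∀ n a → EqLevel (suc n) n (lift n a) a
  lift-≈ zero    x        = refl
  lift-≈ (suc n) (inj₁ x) = refl
  lift-≈ (suc n) (inj₂ A) =
    (λ c Cc → toWitness Cc) ,
    (λ a Aa → lift n a , fromWitness (a , Aa , lift-≈ n a) , lift-≈ n a)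

  lift≤′ : ∀ {m n} → m ≤′ n → (a : Level X m) → ∃ λ (b : Level X n) → EqLevel n m b a
  lift≤′ {m} ≤′-refl a = a , EqLevel-refl m a
  lift≤′ {m} {suc n} (≤′-step le) a =
    let b , e = lift≤′ le a in
    lift n b , EqLevel-trans (suc n) n m (lift n b) b a (lift-≈ n b) e

  lift≤ : ∀ {m n} → m ℕ.≤ n → (a : Level X m) → ∃ λ (b : Level X n) → EqLevel n m b a
  lift≤ = lift≤′ ∘ ℕ.≤⇒≤′

  upair : ∀ {n} → Level X n → Level X n → Level X (suc n)
  upair {n} a b = inj₂ λ c → ⌊ lem {EqLevel n n c a ⊎ EqLevel n n c b} ⌋

  upair-correct : ∀ {n} (a b : Level X n) → IsUnorderedPair (suc n , upair a b) (n , a) (n , b)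
  upair-correct {n} a b t = mk⇔ fwd bwd
    where
    fwd : t ∈ (suc n , upair a b) → t ≈ (n , a) ⊎ t ≈ (n , b)
    fwd (c , Cc , e) with toWitness {a? = lem} Cc
    ... | inj₁ d = inj₁ (≈-trans {u = t} {n , c} {n , a} e d)
    ... | inj₂ d = inj₂ (≈-trans {u = t} {n , c} {n , b} e d)
    bwd : t ≈ (n , a) ⊎ t ≈ (n , b) → t ∈ (suc n , upair a b)
    bwd (inj₁ e) = a , fromWitness (inj₁ (EqLevel-refl n a)) , e
    bwd (inj₂ e) = b , fromWitness (inj₂ (EqLevel-refl n b)) , e

  upair-exists : (v w : V X) → ∃ λ s → IsUnorderedPair s v w
  upair-exists v@(m , a) w@(n , b) =
    let a′ , d = lift≤ (ℕ.m≤m+n m n) a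
        b′ , e = lift≤ (ℕ.m≤n+m n m) b
        s = suc (m ℕ.+ n) , upair a′ b′
    in s , UnorderedPair-resp {s = s} {s} {_ , a′} {_ , b′} {v} {w} (≈-refl {v = s}) d e (upair-correct a′ b′)

  pair-exists : ∀ {n} (a b : Level X n) →
    ∃ λ (z : Level X (suc (suc n))) → IsPair (suc (suc n) , z) (n , a) (n , b)
  pair-exists {n} a b = upair (upair a a) (upair a b) , λ s → mk⇔ (fwd s) (bwd s)
    where
    z : V X
    z = suc (suc n) , upair (upair a a) (upair a b)
    S : Level X n → Level X n → V X
    S c d = suc n , upair c d
    fwd : ∀ s → s ∈ z → IsUnorderedPair s (n , a) (n , a) ⊎ IsUnorderedPair s (n , a) (n , b)
    fwd s s∈z with to (upair-correct (upair a a) (upair a b) s) s∈z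
    ... | inj₁ e = inj₁ (UnorderedPair-resp {s = S a a} {s} {n , a} {n , a} {n , a} {n , a}
                     (≈-sym {v = s} {S a a} e) (EqLevel-refl n a) (EqLevel-refl n a) (upair-correct a a))
    ... | inj₂ e = inj₂ (UnorderedPair-resp {s = S a b} {s} {n , a} {n , b} {n , a} {n , b}
                     (≈-sym {v = s} {S a b} e) (EqLevel-refl n a) (EqLevel-refl n b) (upair-correct a b))
    bwd : ∀ s → IsUnorderedPair s (n , a) (n , a) ⊎ IsUnorderedPair s (n , a) (n , b) → s ∈ z
    bwd s (inj₁ i) = from (upair-correct (upair a a) (upair a b) s)
      (inj₁ (UnorderedPair-unique {s = s} {S a a} {n , a} {n , a} i (upair-correct a a)))
    bwd s (inj₂ i) = from (upair-correct (upair a a) (upair a b) s)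
      (inj₂ (UnorderedPair-unique {s = s} {S a b} {n , a} {n , b} i (upair-correct a b)))

  -- Each entry costs two levels, and only the head has to be lifted. An upper bound in place of the
  -- exact level 2k avoids transport along 2(k + 1) = 2 + 2k.
  tuple-exists : ∀ k {n} → 2 ℕ.* k ℕ.≤ n → (xs : Vector X (suc k)) →
    ∃ λ (z : Level X n) → IsTuple (n , z) (atom ∘ xs)
  tuple-exists zero le xs = lift≤ z≤n (xs zero)
  tuple-exists (suc k) {n} le xs with subst (ℕ._≤ n) (ℕ.*-suc 2 k) le
  tuple-exists (suc k) {suc (suc n)} le xs | s≤s (s≤s le′) =
    let s , t = tuple-exists k le′ (tail xs)
        x , e = lift≤ {n = n} z≤n (head xs)
        z , p = pair-exists x s
    in z , (n , s) , t ,
       Pair-resp {z = _ , z} {_ , z} {n , x} {n , s} {atom (head xs)} {n , s}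
         (EqLevel-refl (suc (suc n)) z) e (EqLevel-refl n s) p

  -- Kuratowski's argument, from the defining property and not from a particular code of the pair.
  -- As {v} is {v′} or {v′ , w′}, the first entries agree; each second entry occurs in the other
  -- pair, and if both equal a first entry then all four coincide.
  Pair-injective : ∀ {z v w v′ w′ : V X} → IsPair z v w → IsPair z v′ w′ → v ≈ v′ × w ≈ w′
  Pair-injective {z} {v} {w} {v′} {w′} h k = v≈v′ , w≈w′
    where
    v≈v′ : v ≈ v′
    v≈v′ with upair-exists v v
    ... | s , i with to (k s) (from (h s) (inj₁ i))
    ...   | inj₁ j with to (i v′) (from (j v′) (inj₁ (≈-refl {v = v′})))
    ...     | inj₁ e = ≈-sym {v = v′} {v} e
    ...     | inj₂ e = ≈-sym {v = v′} {v} e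
    v≈v′ | s , i | inj₂ j with to (i v′) (from (j v′) (inj₁ (≈-refl {v = v′})))
    ...     | inj₁ e = ≈-sym {v = v′} {v} e
    ...     | inj₂ e = ≈-sym {v = v′} {v} e
    w′-cases : w′ ≈ v ⊎ w′ ≈ w
    w′-cases with upair-exists v′ w′
    ... | s , i with to (h s) (from (k s) (inj₂ i)) | from (i w′) (inj₂ (≈-refl {v = w′}))
    ...   | inj₂ j | w′∈s = to (j w′) w′∈s
    ...   | inj₁ j | w′∈s with to (j w′) w′∈s
    ...     | inj₁ e = inj₁ e
    ...     | inj₂ e = inj₁ e
    w-cases : w ≈ v′ ⊎ w ≈ w′
    w-cases with upair-exists v w
    ... | s , i with to (k s) (from (h s) (inj₂ i)) | from (i w) (inj₂ (≈-refl {v = w}))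
    ...   | inj₂ j | w∈s = to (j w) w∈s
    ...   | inj₁ j | w∈s with to (j w) w∈s
    ...     | inj₁ e = inj₁ e
    ...     | inj₂ e = inj₁ e
    w≈w′ : w ≈ w′
    w≈w′ with w-cases | w′-cases
    ... | inj₂ e | _      = e
    ... | inj₁ e | inj₂ d = ≈-sym {v = w′} {w} d
    ... | inj₁ e | inj₁ d = ≈-trans {u = w} {v′} {w′} e
          (≈-trans {u = v′} {v} {w′} (≈-sym {v = v} {v′} v≈v′) (≈-sym {v = w′} {v} d))

  Tuple-injective : ∀ {k} {z : V X} {vs ws : Vector (V X) (suc k)} →
    IsTuple z vs → IsTuple z ws → ∀ i → vs i ≈ ws i
  Tuple-injective {zero} {z} {vs} {ws} d e zero = ≈-trans {u = vs zero} {z} (≈-sym {v = z} d) e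
  Tuple-injective {suc k} {z} {vs} {ws} (s , d , p) (t , e , q) i
    with Pair-injective {z} {vs zero} {s} {ws zero} {t} p q
  Tuple-injective {suc k} (s , d , p) (t , e , q) zero    | v≈w , s≈t = v≈w
  Tuple-injective {suc k} {z} {vs} {ws} (s , d , p) (t , e , q) (suc i) | v≈w , s≈t =
    Tuple-injective {k} {t} {tail vs} {tail ws}
      (Tuple-resp {z = s} {t} {tail vs} s≈t (λ j → ≈-refl {v = tail vs j}) d) e i

  ∈-relation : Extensionality 0ℓ 0ℓ → ∀ {k} (R : Pred (Vector X (suc k)) 0ℓ) xs →
    R xs ⇔ (∃ λ z → IsTuple z (atom ∘ xs) × z ∈ relation lem k R)
  ∈-relation ext {k} R xs = mk⇔ fwd bwd
    where
    fwd : R xs → ∃ λ z → IsTuple z (atom ∘ xs) × z ∈ relation lem k R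
    fwd r = let z , t = tuple-exists k ℕ.≤-refl xs in
      (_ , z) , t , z , fromWitness (xs , t , r) , EqLevel-refl (2 ℕ.* k) z
    bwd : (∃ λ z → IsTuple z (atom ∘ xs) × z ∈ relation lem k R) → R xs
    bwd (z , t , v , Rv , z≈v) with toWitness {a? = lem} Rv
    -- `R` is a predicate on functions, and injectivity of tuples identifies `xs` and `ys` only
    -- entrywise.
    ... | ys , t′ , r = subst R (ext (λ i → sym (xs≈ys i))) r
      where
      xs≈ys : ∀ i → xs i ≡ ys i
      xs≈ys = Tuple-injective {k} {_ , v} {atom ∘ xs} {atom ∘ ys}
        (Tuple-resp {z = z} {_ , v} {atom ∘ xs} z≈v (λ j → refl) t) t′

-- Bounded formulas for pairs and tuples

upairF : ∀ {n} (s v w : Fin n) → Δ₀ n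
upairF s v w = conj (conj (v ∊ s) (w ∊ s)) (all∈ s (disj (zero ≐ suc v) (zero ≐ suc w)))

pairF : ∀ {n} (z v w : Fin n) → Δ₀ n
pairF z v w =
  conj (conj (ex∈ z (upairF zero (suc v) (suc v))) (ex∈ z (upairF zero (suc v) (suc w))))
       (all∈ z (disj (upairF zero (suc v) (suc v)) (upairF zero (suc v) (suc w))))

-- Since (v , s) = {{v} , {v , s}}, the quantifier over s is bounded by the
-- members of z.
tupleF : ∀ {k n} (z : Fin n) (vs : Fin (suc k) → Fin n) → Δ₀ n
tupleF {zero}  z vs = z ≐ vs zero
tupleF {suc k} z vs =
  ex∈ z (ex∈ zero (conj (tupleF zero (λ i → suc (suc (vs (suc i)))))
                        (pairF (suc (suc z)) (suc (suc (head vs))) zero)))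

module _ (lem : ExcludedMiddle 0ℓ) {X : Set} where

  upairF-correct : ∀ {n} {ρ : Vector (V X) n} s v w →
    (ρ ⊨Δ₀ upairF s v w) ⇔ IsUnorderedPair (ρ s) (ρ v) (ρ w)
  upairF-correct {ρ = ρ} s v w = mk⇔ fwd bwd
    where
    fwd : ρ ⊨Δ₀ upairF s v w → IsUnorderedPair (ρ s) (ρ v) (ρ w)
    fwd ((v∈s , w∈s) , h) t = mk⇔ (h t) λ where
      (inj₁ e) → ∈-respˡ {v = t} {ρ v} {ρ s} e v∈s
      (inj₂ e) → ∈-respˡ {v = t} {ρ w} {ρ s} e w∈s
    bwd : IsUnorderedPair (ρ s) (ρ v) (ρ w) → ρ ⊨Δ₀ upairF s v w
    bwd h = (from (h (ρ v)) (inj₁ (≈-refl {v = ρ v})) , from (h (ρ w)) (inj₂ (≈-refl {v = ρ w}))) ,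
            λ t → to (h t)

  pairF-correct : ∀ {n} {ρ : Vector (V X) n} z v w →
    (ρ ⊨Δ₀ pairF z v w) ⇔ IsPair (ρ z) (ρ v) (ρ w)
  pairF-correct {n} {ρ} z v w = mk⇔ fwd bwd
    where
    module U t = Equivalence (upairF-correct {ρ = t ∷ ρ} zero (suc v) (suc v))
    module W t = Equivalence (upairF-correct {ρ = t ∷ ρ} zero (suc v) (suc w))
    fwd : ρ ⊨Δ₀ pairF z v w → IsPair (ρ z) (ρ v) (ρ w)
    fwd (((s , s∈z , i) , (t , t∈z , j)) , h) x = mk⇔ x-cases λ where
        (inj₁ k) → ∈-respˡ {v = x} {s} {ρ z}
          (UnorderedPair-unique {s = x} {s} {ρ v} {ρ v} k (U.to s i)) s∈z
        (inj₂ k) → ∈-respˡ {v = x} {t} {ρ z}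
          (UnorderedPair-unique {s = x} {t} {ρ v} {ρ w} k (W.to t j)) t∈z
      where
      x-cases : x ∈ ρ z → IsUnorderedPair x (ρ v) (ρ v) ⊎ IsUnorderedPair x (ρ v) (ρ w)
      x-cases x∈z with h x x∈z
      ... | inj₁ k = inj₁ (U.to x k)
      ... | inj₂ k = inj₂ (W.to x k)
    bwd : IsPair (ρ z) (ρ v) (ρ w) → ρ ⊨Δ₀ pairF z v w
    bwd h =
      let s , i = upair-exists lem (ρ v) (ρ v)
          t , j = upair-exists lem (ρ v) (ρ w)
      in ((s , from (h s) (inj₁ i) , U.from s i) , (t , from (h t) (inj₂ j) , W.from t j)) , x-cases
      where
      x-cases : ∀ x → x ∈ ρ z →
        (x ∷ ρ ⊨Δ₀ upairF zero (suc v) (suc v)) ⊎ (x ∷ ρ ⊨Δ₀ upairF zero (suc v) (suc w))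
      x-cases x x∈z with to (h x) x∈z
      ... | inj₁ k = inj₁ (U.from x k)
      ... | inj₂ k = inj₂ (W.from x k)

  tupleF-correct : ∀ {k n} {ρ : Vector (V X) n} z (vs : Fin (suc k) → Fin n) →
    (ρ ⊨Δ₀ tupleF z vs) ⇔ IsTuple (ρ z) (ρ ∘ vs)
  tupleF-correct {zero} z vs = ⇔.refl
  tupleF-correct {suc k} {n} {ρ} z vs = mk⇔ fwd bwd
    where
    fwd : ρ ⊨Δ₀ tupleF z vs → IsTuple (ρ z) (ρ ∘ vs)
    fwd (u , u∈z , s , s∈u , t , p) =
      s , to (tupleF-correct {ρ = s ∷ u ∷ ρ} zero (λ i → suc (suc (vs (suc i))))) t ,
      to (pairF-correct {ρ = s ∷ u ∷ ρ} (suc (suc z)) (suc (suc (head vs))) zero) p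
    bwd : IsTuple (ρ z) (ρ ∘ vs) → ρ ⊨Δ₀ tupleF z vs
    bwd (s , t , p) =
      let u , i = upair-exists lem (ρ (head vs)) s in
      u , from (p u) (inj₂ i) , s , from (i s) (inj₂ (≈-refl {v = s})) ,
      from (tupleF-correct {ρ = s ∷ u ∷ ρ} zero (λ i → suc (suc (vs (suc i))))) t ,
      from (pairF-correct {ρ = s ∷ u ∷ ρ} (suc (suc z)) (suc (suc (head vs))) zero) p

-- First-order formulas over ℕ⁺

-- Every predicate on ℕ⁺ serves as a relation symbol. Whatever need not be taken apart on the
-- nonstandard side is packed into one predicate and dealt with on the standard side.
data Fm (n : ℕ) : Set₁ where
  rel       : ∀ {k} → Pred (Vector ℕ⁺ (suc k)) 0ℓ → Vector (Fin n) (suc k) → Fm n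
  eq        : Fin n → Fin n → Fm n
  neg       : Fm n → Fm n
  conj impl : Fm n → Fm n → Fm n
  all ex    : Fm (suc n) → Fm n

Interpretation : Set → Set₁
Interpretation Y = ∀ {k} → Pred (Vector ℕ⁺ (suc k)) 0ℓ → Pred (Vector Y (suc k)) 0ℓ

Sat : {Y : Set} → Interpretation Y → ∀ {n} → Vector Y n → Fm n → Set
Sat I ρ (rel R σ)  = I R (ρ ∘ σ)
Sat I ρ (eq i j)   = ρ i ≡ ρ j
Sat I ρ (neg φ)    = ¬ Sat I ρ φ
Sat I ρ (conj φ ψ) = Sat I ρ φ × Sat I ρ ψ
Sat I ρ (impl φ ψ) = Sat I ρ φ → Sat I ρ ψ
Sat I ρ (all φ)    = ∀ x → Sat I (x ∷ ρ) φ
Sat I ρ (ex φ)     = ∃ λ x → Sat I (x ∷ ρ) φ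

#params : ∀ {n} → Fm n → ℕ
#params (rel R σ)  = 1
#params (eq i j)   = 0
#params (neg φ)    = #params φ
#params (conj φ ψ) = #params φ ℕ.+ #params ψ
#params (impl φ ψ) = #params φ ℕ.+ #params ψ
#params (all φ)    = #params φ
#params (ex φ)     = #params φ

params : ExcludedMiddle 0ℓ → ∀ {n} (φ : Fm n) → Vector (V ℕ⁺) (#params φ)
params lem (rel {k} R σ) = relation lem k R ∷ []
params lem (eq i j)      = []
params lem (neg φ)       = params lem φ
params lem (conj φ ψ)    = params lem φ ++ params lem ψ
params lem (impl φ ψ)    = params lem φ ++ params lem ψ
params lem (all φ)       = params lem φ
params lem (ex φ)        = params lem φ

-- N, r and vs are the Δ₀-variables that stand for the set of all numbers, for
-- the parameters and for the variables of the formula.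
bounded : ∀ {n} (φ : Fm n) {m} → Fin m → Vector (Fin m) (#params φ) → Vector (Fin m) n → Δ₀ m
bounded (rel R σ)  N r vs = ex∈ (r zero) (tupleF zero (suc ∘ vs ∘ σ))
bounded (eq i j)   N r vs = vs i ≐ vs j
bounded (neg φ)    N r vs = neg (bounded φ N r vs)
bounded (conj φ ψ) N r vs = conj (bounded φ N (r ∘ (_↑ˡ _)) vs) (bounded ψ N (r ∘ (_ ↑ʳ_)) vs)
bounded (impl φ ψ) N r vs = impl (bounded φ N (r ∘ (_↑ˡ _)) vs) (bounded ψ N (r ∘ (_ ↑ʳ_)) vs)
bounded (all φ)    N r vs = all∈ N (bounded φ (suc N) (suc ∘ r) (zero ∷ suc ∘ vs))
bounded (ex φ)     N r vs = ex∈ N (bounded φ (suc N) (suc ∘ r) (zero ∷ suc ∘ vs))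

module _ (lem : ExcludedMiddle 0ℓ) {X : Set} (⋆_ : V ℕ⁺ → V X) (I : Interpretation X)
  (I-relation : ∀ {k} (R : Pred (Vector ℕ⁺ (suc k)) 0ℓ) xs →
                I R xs ⇔ (∃ λ z → IsTuple z (atom ∘ xs) × z ∈ ⋆ relation lem k R))
  where

  private
    𝐍 : V X
    𝐍 = set λ _ → true

  -- Used twice around `transfer`: with `id` for the standard universe and with `*_` for the
  -- extension.
  bounded-correct : ∀ {n} (φ : Fm n) {m} (ρ : Vector (V X) m) N r vs (xs : Vector X n) →
    ρ N ≈ 𝐍 → (∀ j → ρ (r j) ≈ ⋆ params lem φ j) → (∀ i → ρ (vs i) ≈ atom (xs i)) →
    (ρ ⊨Δ₀ bounded φ N r vs) ⇔ Sat I xs φ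
  bounded-correct (rel {k} R σ) ρ N r vs xs hN hr hv = ⇔.trans (mk⇔ fwd bwd) (⇔.sym (I-relation R (xs ∘ σ)))
    where
    rs : V X
    rs = ρ (r zero)
    fwd : ρ ⊨Δ₀ bounded (rel R σ) N r vs → ∃ λ z → IsTuple z (atom ∘ xs ∘ σ) × z ∈ ⋆ relation lem k R
    fwd (z , z∈r , t) = z ,
      Tuple-resp {z = z} {z} {ρ ∘ vs ∘ σ} (≈-refl {v = z}) (hv ∘ σ)
        (to (tupleF-correct lem {ρ = z ∷ ρ} zero (suc ∘ vs ∘ σ)) t) ,
      ∈-respʳ {v = z} {rs} (hr zero) z∈r
    bwd : (∃ λ z → IsTuple z (atom ∘ xs ∘ σ) × z ∈ ⋆ relation lem k R) → ρ ⊨Δ₀ bounded (rel R σ) N r vs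
    bwd (z , t , z∈r) = z , ∈-respʳ {v = z} {⋆ relation lem k R} {rs} (≈-sym {v = rs} (hr zero)) z∈r ,
      from (tupleF-correct lem {ρ = z ∷ ρ} zero (suc ∘ vs ∘ σ))
        (Tuple-resp {z = z} {z} {atom ∘ xs ∘ σ} {ρ ∘ vs ∘ σ} (≈-refl {v = z})
          (λ i → ≈-sym {v = ρ (vs (σ i))} (hv (σ i))) t)
  bounded-correct (eq i j) ρ N r vs xs hN hr hv = mk⇔
    (λ e → ≈-trans {u = atom (xs i)} {ρ (vs i)} {atom (xs j)} (≈-sym {v = ρ (vs i)} (hv i))
             (≈-trans {u = ρ (vs i)} {ρ (vs j)} e (hv j)))
    (λ e → ≈-trans {u = ρ (vs i)} {atom (xs i)} {ρ (vs j)} (hv i)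
             (≈-trans {u = atom (xs i)} {atom (xs j)} {ρ (vs j)} e (≈-sym {v = ρ (vs j)} (hv j))))
  bounded-correct (neg φ) ρ N r vs xs hN hr hv =
    let ih = bounded-correct φ ρ N r vs xs hN hr hv in mk⇔ (_∘ from ih) (_∘ to ih)
  bounded-correct (conj φ ψ) ρ N r vs xs hN hr hv =
    let ih₁ = bounded-correct φ ρ N _ vs xs hN
                (λ j → subst (λ v → ρ (r (j ↑ˡ _)) ≈ ⋆ v) (lookup-++ˡ (params lem φ) _ j) (hr (j ↑ˡ _))) hv
        ih₂ = bounded-correct ψ ρ N _ vs xs hN
                (λ j → subst (λ v → ρ (r (_ ↑ʳ j)) ≈ ⋆ v) (lookup-++ʳ (params lem φ) _ j) (hr (_ ↑ʳ j))) hv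
    in mk⇔ (λ (p , q) → to ih₁ p , to ih₂ q) (λ (p , q) → from ih₁ p , from ih₂ q)
  bounded-correct (impl φ ψ) ρ N r vs xs hN hr hv =
    let ih₁ = bounded-correct φ ρ N _ vs xs hN
                (λ j → subst (λ v → ρ (r (j ↑ˡ _)) ≈ ⋆ v) (lookup-++ˡ (params lem φ) _ j) (hr (j ↑ˡ _))) hv
        ih₂ = bounded-correct ψ ρ N _ vs xs hN
                (λ j → subst (λ v → ρ (r (_ ↑ʳ j)) ≈ ⋆ v) (lookup-++ʳ (params lem φ) _ j) (hr (_ ↑ʳ j))) hv
    in mk⇔ (λ f → to ih₂ ∘ f ∘ from ih₁) (λ f → from ih₂ ∘ f ∘ to ih₁)
  bounded-correct (all φ) ρ N r vs xs hN hr hv = mk⇔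
    (λ f x → to (bounded-correct φ (atom x ∷ ρ) _ _ _ (x ∷ xs) hN hr λ where
        zero → refl
        (suc i) → hv i)
      (f (atom x) (∈-respʳ {v = atom x} {𝐍} {ρ N} (≈-sym {v = ρ N} hN) (x , tt , refl))))
    (λ f v v∈N → let x , _ , e = ∈-respʳ {v = v} {ρ N} {𝐍} hN v∈N in
      from (bounded-correct φ (v ∷ ρ) _ _ _ (x ∷ xs) hN hr λ where
        zero → e
        (suc i) → hv i)
      (f x))
  bounded-correct (ex φ) ρ N r vs xs hN hr hv = mk⇔
    (λ (v , v∈N , p) → let x , _ , e = ∈-respʳ {v = v} {ρ N} {𝐍} hN v∈N in
      x , to (bounded-correct φ (v ∷ ρ) _ _ _ (x ∷ xs) hN hr λ where
        zero → e
        (suc i) → hv i)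
      p)
    (λ (x , p) → atom x , ∈-respʳ {v = atom x} {𝐍} {ρ N} (≈-sym {v = ρ N} hN) (x , tt , refl) ,
      from (bounded-correct φ (atom x ∷ ρ) _ _ _ (x ∷ xs) hN hr λ where
        zero → refl
        (suc i) → hv i)
      p)

-- Powers of primes

nonZero : (n : ℕ⁺) → NonZero (value n)
nonZero (zero  , irr p) = ⊥-elim-irr (ℕ.≢-nonZero⁻¹ 0 {{p}} refl)
nonZero (suc n , _)     = _

suc⁺ : ℕ⁺ → ℕ⁺
suc⁺ n = suc (value n) , irr _

infixl 21 _*⁺_
infixr 22 _^⁺_

_*⁺_ _^⁺_ : ℕ⁺ → ℕ⁺ → ℕ⁺
m *⁺ n = value m ℕ.* value n , irr (ℕ.m*n≢0 _ _ {{nonZero m}} {{nonZero n}})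
m ^⁺ n = value m ℕ.^ value n , irr (ℕ.m^n≢0 _ (value n) {{nonZero m}})

Prime⁺ : Pred ℕ⁺ 0ℓ
Prime⁺ q = Prime (value q)

prime≢1 : ∀ {p} → Prime p → p ≢ 1
prime≢1 pp refl with prime⇒nonTrivial pp
... | ()

prime-∣-prime : ∀ {p q} → Prime p → Prime q → p ∣.∣ q → p ≡ q
prime-∣-prime pp pq p∣q with prime⇒irreducible pq p∣q
... | inj₁ p≡1 = ⊥-elim (prime≢1 pp p≡1)
... | inj₂ p≡q = p≡q

-- By Euclid's lemma each factor q has to divide `y` and can be cancelled there.
prime-∤-mono : ∀ {q k y} → Prime q → ¬ (q ∣.∣ k) → ∀ e → q ℕ.^ e ∣.∣ y ℕ.* k → q ℕ.^ e ∣.∣ y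
prime-∤-mono pq q∤k zero h = ∣.1∣ _
prime-∤-mono {q} {k} {y} pq q∤k (suc e) h with euclidsLemma y k pq (∣.∣-trans (∣.m∣m*n (q ℕ.^ e)) h)
... | inj₂ q∣k = ⊥-elim (q∤k q∣k)
... | inj₁ (∣.divides y′ refl) rewrite ℕ.*-comm y′ q =
  ∣.*-monoʳ-∣ q (prime-∤-mono pq q∤k e
    (∣.*-cancelˡ-∣ q {{prime⇒nonZero pq}} (subst (q ℕ.* q ℕ.^ e ∣.∣_) (ℕ.*-assoc q y′ k) h)))

^-∣ : ∀ q {a b} → a ℕ.≤ b → q ℕ.^ a ∣.∣ q ℕ.^ b
^-∣ q {a} a≤b with ℕ.m≤n⇒∃[o]m+o≡n a≤b
... | o , refl = ∣.divides (q ℕ.^ o) (trans (ℕ.^-distribˡ-+-* q a o) (ℕ.*-comm (q ℕ.^ a) _))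

prime-power-divisor : ∀ {q m} a → Prime q → m ∣.∣ q ℕ.^ suc a → m ≢ q ℕ.^ suc a → m ∣.∣ q ℕ.^ a
prime-power-divisor {q} {m} a pq (∣.divides k e) m≢ with q ∣.∣? k
... | yes (∣.divides k′ refl) = ∣.divides k′ (ℕ.*-cancelˡ-≡ _ _ q {{prime⇒nonZero pq}}
        (trans e (trans (cong (ℕ._* m) (ℕ.*-comm k′ q)) (ℕ.*-assoc q k′ m))))
... | no q∤k = ⊥-elim (m≢ (∣.∣-antisym (∣.divides k e)
        (prime-∤-mono pq q∤k (suc a) (subst (q ℕ.^ suc a ∣.∣_) (trans e (ℕ.*-comm k m)) ∣.∣-refl))))

prime-ℙ : ∀ {p} → T (ℙ p) → Prime⁺ p
prime-ℙ = toWitness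

prime-exact-power : ∀ {q} → Prime q → ∀ {n} → NonZero n → ∀ e → q ℕ.^ e ∣.∣ n →
  ∃ λ f → e ℕ.≤ f × ∃ λ x → q ℕ.^ f ℕ.* x ≡ n × ¬ (q ∣.∣ x)
prime-exact-power {q} pq {n} n≢0 e (∣.divides x n≡) =
  -- Each further factor q makes the cofactor strictly smaller, so its successor is enough fuel.
  go (suc x) x e ℕ.≤-refl (trans (ℕ.*-comm (q ℕ.^ e) x) (sym n≡))
  where
  go : ∀ fuel x e → x ℕ.< fuel → q ℕ.^ e ℕ.* x ≡ n →
    ∃ λ f → e ℕ.≤ f × ∃ λ x → q ℕ.^ f ℕ.* x ≡ n × ¬ (q ∣.∣ x)
  go (suc fuel) x e (s≤s x≤) d with q ∣.∣? x
  ... | no q∤x = e , ℕ.≤-refl , x , d , q∤x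
  ... | yes (∣.divides zero refl) = ⊥-elim (ℕ.≢-nonZero⁻¹ n {{n≢0}} (trans (sym d) (ℕ.*-zeroʳ (q ℕ.^ e))))
  ... | yes (∣.divides x′@(suc _) refl) =
    let f , le , r = go fuel x′ (suc e)
          (ℕ.<-≤-trans (ℕ.m<m*n x′ q (ℕ.nonTrivial⇒n>1 q {{prime⇒nonTrivial pq}})) x≤)
          (trans (cong (ℕ._* x′) (ℕ.*-comm q (q ℕ.^ e)))
            (trans (ℕ.*-assoc (q ℕ.^ e) q x′) (trans (cong (q ℕ.^ e ℕ.*_) (ℕ.*-comm q x′)) d)))
    in f , ℕ.<⇒≤ le , r

-- Counting

count : 𝒫 ℕ⁺ → ℕ → ℕ
count f zero    = 0
count f (suc k) = if f (suc k , irr _) then suc (count f k) else count f k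

-- `pred` makes the count strict. On members of `f` this is the position in increasing order,
-- starting from 0.
rank : 𝒫 ℕ⁺ → ℕ⁺ → ℕ
rank f q = count f (ℕ.pred (value q))

_⊑_ : Rel (𝒫 ℕ⁺) 0ℓ
f ⊑ g = ∀ q → T (f q) → T (g q)

count-⊑ : ∀ {f g} → f ⊑ g → ∀ k → count f k ℕ.≤ count g k
count-⊑ h zero = z≤n
count-⊑ {f} {g} h (suc k) with f (suc k , irr _) | g (suc k , irr _) | h (suc k , irr _)
... | true  | true  | _ = s≤s (count-⊑ h k)
... | true  | false | i = ⊥-elim (i tt)
... | false | true  | _ = ℕ.m≤n⇒m≤1+n (count-⊑ h k)
... | false | false | _ = count-⊑ h k

count-step : ∀ f k → count f k ℕ.≤ count f (suc k)
count-step f k with f (suc k , irr _)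
... | true  = ℕ.n≤1+n _
... | false = ℕ.≤-refl

count-mono′ : ∀ f {k l} → k ≤′ l → count f k ℕ.≤ count f l
count-mono′ f ≤′-refl = ℕ.≤-refl
count-mono′ f (≤′-step {l} h) = ℕ.≤-trans (count-mono′ f h) (count-step f l)

count-mono : ∀ f {k l} → k ℕ.≤ l → count f k ℕ.≤ count f l
count-mono f = count-mono′ f ∘ ℕ.≤⇒≤′

count-suc : ∀ f k → T (f (suc k , irr _)) → count f (suc k) ≡ suc (count f k)
count-suc f k h with f (suc k , irr _)
... | true = refl

rank-< : ∀ f q {k} → T (f q) → value q ℕ.≤ k → rank f q ℕ.< count f k
rank-< f (zero  , irr p) h le = ⊥-elim-irr (ℕ.≢-nonZero⁻¹ 0 {{p}} refl)
rank-< f (suc q , _) {k} h le = ℕ.≤-trans (ℕ.≤-reflexive (sym (count-suc f q h))) (count-mono f le)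

rank-strict : ∀ f q r → T (f q) → value q ℕ.< value r → rank f q ℕ.< rank f r
rank-strict f q r hq q<r =
  rank-< f q hq (ℕ.≤-pred (subst (suc (value q) ℕ.≤_) (sym (ℕ.suc-pred _ {{nonZero r}})) q<r))

rank-injective : ∀ f q r → T (f q) → T (f r) → rank f q ≡ rank f r → q ≡ r
rank-injective f q r hq hr e with ℕ.<-cmp (value q) (value r)
... | tri< q<r _ _ = ⊥-elim (ℕ.<⇒≢ (rank-strict f q r hq q<r) e)
... | tri≈ _ q≡r _ = value-injective q≡r
... | tri> _ _ r<q = ⊥-elim (ℕ.<⇒≢ (rank-strict f r q hr r<q) (sym e))

count-bounded′ : ∀ f k {l} → (∀ q → T (f q) → value q ℕ.≤ k) → k ≤′ l → count f l ≡ count f k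
count-bounded′ f k h ≤′-refl = refl
count-bounded′ f k h (≤′-step {l} k≤l) with f (suc l , irr _) | h (suc l , irr _)
... | false | _ = count-bounded′ f k h k≤l
... | true  | i = ⊥-elim (ℕ.<⇒≱ (s≤s (ℕ.≤′⇒≤ k≤l)) (i tt))

count-≡⇒⊒ : ∀ {f g} → f ⊑ g → ∀ k → count f k ≡ count g k → ∀ q → value q ℕ.≤ k → T (g q) → T (f q)
count-≡⇒⊒ {f} {g} h zero    e (zero , irr p) le gq = ⊥-elim-irr (ℕ.≢-nonZero⁻¹ 0 {{p}} refl)
count-≡⇒⊒ {f} {g} h (suc k) e q le gq with ℕ.m≤n⇒m<n∨m≡n le
... | inj₂ refl = last gq
  where
  last : T (g (suc k , irr _)) → T (f (suc k , irr _))
  last _ with f (suc k , irr _) | g (suc k , irr _)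
  ... | true  | true = tt
  ... | false | true = ⊥-elim (ℕ.<⇒≱ (ℕ.≤-reflexive (sym e)) (count-⊑ h k))
... | inj₁ (s≤s q≤k) = count-≡⇒⊒ h k e′ q q≤k gq
  where
  e′ : count f k ≡ count g k
  e′ with f (suc k , irr _) | g (suc k , irr _) | h (suc k , irr _)
  ... | true  | true  | _ = ℕ.suc-injective e
  ... | true  | false | i = ⊥-elim (i tt)
  ... | false | true  | _ = ⊥-elim (ℕ.<⇒≱ (ℕ.≤-reflexive (sym e)) (count-⊑ h k))
  ... | false | false | _ = e

T-≡ : ∀ {a b} → (T a → T b) → (T b → T a) → a ≡ b
T-≡ {true}  {true}  i j = refl
T-≡ {true}  {false} i j = ⊥-elim (i tt)
T-≡ {false} {true}  i j = ⊥-elim (j tt)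
T-≡ {false} {false} i j = refl

-- Beyond its bound a count no longer grows, so both can be compared at the maximum of the two
-- bounds; there an inclusion that misses an element would make them differ.
count-≡⇒≡ : Extensionality 0ℓ 0ℓ → ∀ {f g} k l → f ⊑ g →
  (∀ q → T (f q) → value q ℕ.≤ k) → (∀ q → T (g q) → value q ℕ.≤ l) →
  count f k ≡ count g l → f ≡ g
count-≡⇒≡ ext {f} {g} k l h f≤k g≤l e = ext λ q → T-≡ (h q)
  λ gq → count-≡⇒⊒ h (k ℕ.⊔ l) e′ q (ℕ.≤-trans (g≤l q gq) (ℕ.m≤n⊔m k l)) gq
  where
  e′ : count f (k ℕ.⊔ l) ≡ count g (k ℕ.⊔ l)
  e′ = trans (count-bounded′ f k f≤k (ℕ.≤⇒≤′ (ℕ.m≤m⊔n k l)))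
         (trans e (sym (count-bounded′ g l g≤l (ℕ.≤⇒≤′ (ℕ.m≤n⊔m k l)))))

-- The largest member up to `k` has all the others below it. Repetition under the new bound lists
-- members in decreasing order, which `chain` imitates for generators.
count-pick : ∀ f k {j} → suc j ℕ.≤ count f k → ∃ λ q → T (f q) × value q ℕ.≤ k × j ℕ.≤ rank f q
count-pick f (suc k) h with f (suc k , irr _) in eq
... | true  = (suc k , irr _) , subst T (sym eq) tt , ℕ.≤-refl , ℕ.≤-pred h
... | false = let q , fq , q≤k , j≤ = count-pick f k h in q , fq , ℕ.m≤n⇒m≤1+n q≤k , j≤

-- Ultrafilters and upward closed sets

𝒰-up : ∀ {A} → 𝒰 A → ∀ m n → T (A m) → m ∣ n → T (A n)
𝒰-up (_ , h) m n Am m∣n = from (h n) (m , Am , m∣n)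

module Standard (lem : ExcludedMiddle 0ℓ) where

  ⟦_⟧ : Pred ℕ⁺ 0ℓ → 𝒫 ℕ⁺
  ⟦ S ⟧ n = ⌊ lem {S n} ⌋

  ⟦⟧⁺ : {P : Set} → P → T ⌊ lem {P} ⌋
  ⟦⟧⁺ = fromWitness

  ⟦⟧⁻ : {P : Set} → T ⌊ lem {P} ⌋ → P
  ⟦⟧⁻ = toWitness {a? = lem}

  𝒰-⟦⟧ : (S : Pred ℕ⁺ 0ℓ) → ∃ S → (∀ m n → S m → m ∣ n → S n) → 𝒰 ⟦ S ⟧
  𝒰-⟦⟧ S (n , s) up = (n , ⟦⟧⁺ s) , λ k →
    mk⇔ (λ h → k , h , ∣.∣-refl) (λ (m , h , m∣k) → ⟦⟧⁺ (up m k (⟦⟧⁻ h) m∣k))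

  ∣̃-separate : ∀ {X Y : 𝒫 (𝒫 ℕ⁺)} → ¬ (X ∣̃ Y) → ∃ λ A → T (X A) × 𝒰 A × ¬ T (Y A)
  ∣̃-separate {X} {Y} ¬X∣Y with lem {∃ λ A → T (X A) × 𝒰 A × ¬ T (Y A)}
  ... | yes s = s
  ... | no ¬s = ⊥-elim (¬X∣Y Y-contains)
    where
    Y-contains : X ∣̃ Y
    Y-contains A XA UA with lem {T (Y A)}
    ... | yes YA = YA
    ... | no ¬YA = ⊥-elim (¬s (A , XA , UA , ¬YA))

  infix 4 _∋_

  _∋_ : βℕ → Pred ℕ⁺ 0ℓ → Set
  F ∋ S = T (family F ⟦ S ⟧)

  module _ (F : βℕ) where

    ∋-mono : ∀ {S S′ : Pred ℕ⁺ 0ℓ} → (∀ n → S n → S′ n) → F ∋ S → F ∋ S′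
    ∋-mono h = βℕ.↑-closed F _ _ λ n → ⟦⟧⁺ ∘ h n ∘ ⟦⟧⁻

    ∋-∩ : ∀ {S S′ : Pred ℕ⁺ 0ℓ} → F ∋ S → F ∋ S′ → F ∋ (λ n → S n × S′ n)
    ∋-∩ {S} {S′} h h′ = βℕ.↑-closed F _ _
      (λ n i → let s , s′ = to (T-∧ {⟦ S ⟧ n}) i in ⟦⟧⁺ (⟦⟧⁻ s , ⟦⟧⁻ s′)) (βℕ.∩-closed F _ _ h h′)

    ∋-nonempty : ∀ {S : Pred ℕ⁺ 0ℓ} → F ∋ S → ∃ S
    ∋-nonempty {S} h with lem {∃ S}
    ... | yes s = s
    ... | no ¬s = ⊥-elim (βℕ.∅-∉ F (βℕ.↑-closed F _ _ (λ n i → ¬s (n , ⟦⟧⁻ i)) h))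

    ∋-ultra : ∀ (S : Pred ℕ⁺ 0ℓ) → F ∋ S ⊎ F ∋ (λ n → ¬ S n)
    ∋-ultra S with βℕ.ultra F ⟦ S ⟧
    ... | inj₁ h = inj₁ h
    ... | inj₂ h = inj₂ (βℕ.↑-closed F _ _
      (λ n i → ⟦⟧⁺ λ s → subst T (to T-not-≡ i) (⟦⟧⁺ s)) h)

    ∋-T : ∀ A → T (family F A) ⇔ F ∋ (T ∘ A)
    ∋-T A = mk⇔ (βℕ.↑-closed F _ _ λ n → ⟦⟧⁺) (βℕ.↑-closed F _ _ λ n → ⟦⟧⁻)

    ∋-∁ : ∀ {A} → ¬ T (family F A) → F ∋ (λ n → ¬ T (A n))
    ∋-∁ {A} ¬A with ∋-ultra (T ∘ A)
    ... | inj₁ h = ⊥-elim (¬A (from (∋-T A) h))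
    ... | inj₂ h = h

    -- At each step the ultrafilter either settles on the largest value or discards it. This is what
    -- later makes the size and the index constant.
    ∋-finite : ∀ (R : ℕ⁺ → ℕ → Set) k → F ∋ (λ n → ∃ λ i → i ℕ.≤ k × R n i) → ∃ λ i → F ∋ (λ n → R n i)
    ∋-finite R zero h = 0 , ∋-mono (λ { n (.0 , z≤n , r) → r }) h
    ∋-finite R (suc k) h with ∋-ultra (λ n → R n (suc k))
    ... | inj₁ h′ = suc k , h′
    ... | inj₂ h′ = ∋-finite R k (∋-mono shrink (∋-∩ h h′))
      where
      shrink : ∀ n → (∃ λ i → i ℕ.≤ suc k × R n i) × ¬ R n (suc k) → ∃ λ i → i ℕ.≤ k × R n i
      shrink n ((i , i≤ , r) , ¬r) with ℕ.m≤n⇒m<n∨m≡n i≤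
      ... | inj₁ (s≤s i≤k) = i , i≤k , r
      ... | inj₂ refl      = ⊥-elim (¬r r)

  map-βℕ : (ℕ⁺ → ℕ⁺) → βℕ → βℕ
  map-βℕ g F = record
    { family   = λ B → family F (B ∘ g)
    ; ∅-∉      = βℕ.∅-∉ F
    ; ∩-closed = λ A B → βℕ.∩-closed F (A ∘ g) (B ∘ g)
    ; ↑-closed = λ A B h → βℕ.↑-closed F (A ∘ g) (B ∘ g) (h ∘ g)
    ; ultra    = λ A → βℕ.ultra F (A ∘ g)
    }

  -- Among the powers of a prime q, those in the upward closed set A are the
  -- ones from some threshold exponent on.  At n q says that the exponent of q in
  -- n reaches the threshold, Below n q that it falls short of it by at most one.
  -- Exponents start at 1, so the threshold is taken to be at least 2.
  module Layers (A : 𝒫 ℕ⁺) (A-up : ∀ m n → T (A m) → m ∣ n → T (A n)) where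

    record Below (n q : ℕ⁺) : Set where
      constructor below
      field
        prime    : Prime⁺ q
        exponent : ℕ⁺
        divides  : q ^⁺ exponent ∣ n
        next∈A   : T (A (q ^⁺ suc⁺ exponent))

    At : ℕ⁺ → ℕ⁺ → Set
    At n q = ∃ λ e → q ^⁺ suc⁺ e ∣ n × T (A (q ^⁺ suc⁺ e))

    Below-mono : ∀ {m n q} → m ∣ n → Below m q → Below n q
    Below-mono m∣n (below p e d a) = below p e (∣.∣-trans d m∣n) a

    At-mono : ∀ {m n q} → m ∣ n → At m q → At n q
    At-mono m∣n (e , d , a) = e , ∣.∣-trans d m∣n , a

    -- If q divided the quotient n / z, then z would divide n / q. So the quotient is prime to q,
    -- and z carries every power of q that n does.
    At-cofactor : ∀ {z n m q} → Prime⁺ q → z ∣ n → value n ≡ value m ℕ.* value q →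
      At n q → ¬ (z ∣ m) → At z q
    At-cofactor {z} {n} {m} {q} pq (∣.divides k n≡kz) n≡mq (e , d , a) z∤m =
      e , prime-∤-mono pq q∤k (suc (value e)) (subst (_ ∣.∣_) (trans n≡kz (ℕ.*-comm k _)) d) , a
      where
      q∤k : ¬ (value q ∣.∣ k)
      q∤k (∣.divides k′ refl) = z∤m (∣.divides k′ (ℕ.*-cancelʳ-≡ _ _ (value q) {{nonZero q}}
        (trans (sym n≡mq) (trans n≡kz (trans (ℕ.*-assoc k′ _ _)
          (trans (cong (k′ ℕ.*_) (ℕ.*-comm (value q) (value z))) (sym (ℕ.*-assoc k′ _ _))))))))

    -- Were z / y prime to q, then y would carry every power of q that z does and reach the
    -- threshold as well.
    At-gain : ∀ {y z q} → Prime⁺ q → y ∣ z → At z q → ¬ At y q → value y ℕ.* value q ∣.∣ value z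
    At-gain {y} {z} {q} pq (∣.divides k z≡ky) (e , d , a) ¬at with value q ∣.∣? k
    ... | no q∤k = ⊥-elim (¬at (e ,
            prime-∤-mono pq q∤k (suc (value e)) (subst (_ ∣.∣_) (trans z≡ky (ℕ.*-comm k _)) d) , a))
    ... | yes (∣.divides k′ refl) = ∣.divides k′
            (trans z≡ky (trans (ℕ.*-assoc k′ _ _) (cong (k′ ℕ.*_) (ℕ.*-comm (value q) (value y)))))

    module _ (C : 𝒫 ℕ⁺) where

      -- The set T(n) of the overview.
      layer : ℕ⁺ → 𝒫 ℕ⁺
      layer n = ⟦ (λ q → T (C q) × Below n q) ⟧

      layer⁺ : ∀ {n q} → T (C q) → Below n q → T (layer n q)
      layer⁺ c b = fromWitness (c , b)

      layer⁻ : ∀ {n q} → T (layer n q) → T (C q) × Below n q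
      layer⁻ = toWitness {a? = lem}

      layer-mono : ∀ {m n} → m ∣ n → layer m ⊑ layer n
      layer-mono m∣n q h = let c , b = layer⁻ h in layer⁺ c (Below-mono m∣n b)

      layer-bounded : ∀ n q → T (layer n q) → value q ℕ.≤ value n
      layer-bounded n q h = let _ , b = layer⁻ h in
        ∣.∣⇒≤ {{nonZero n}} (∣.∣-trans (q∣q^e b) (Below.divides b))
        where
        -- Exponents are at least 1 here; an exponent 0 would admit primes not dividing `n`, and the
        -- layer could be infinite.
        q∣q^e : (b : Below n q) → q ∣ q ^⁺ Below.exponent b
        q∣q^e b with Below.exponent b
        ... | suc e , _      = ∣.m∣m*n (value q ℕ.^ e)
        ... | zero  , irr p = ⊥-elim-irr (ℕ.≢-nonZero⁻¹ 0 {{p}} refl)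

      -- The exponent of q in n is exactly the threshold.
      record Descent (N i : ℕ) (n q m : ℕ⁺) : Set where
        constructor descent
        field
          split   : value n ≡ value m ℕ.* value q
          member  : T (layer n q)
          size    : count (layer n) (value n) ≡ N
          index   : rank (layer n) q ≡ i
          at      : At n q
          not-at  : ¬ At m q

      Descent-prime : ∀ {N i n q m} → Descent N i n q m → Prime⁺ q
      Descent-prime D = Below.prime (proj₂ (layer⁻ (Descent.member D)))

      -- Powers of other primes are untouched by the division. For `q` itself the power in `At n q`
      -- loses one factor, which is exactly the slack that `Below` allows.
      layer-descent : ∀ {N i n q m} → Descent N i n q m → layer n ⊑ layer m
      layer-descent {n = n} {q} {m} D r h with layer⁻ h
      ... | Cr , below pr e d a with value r ℕ.≟ value q
      ...   | no r≢q = layer⁺ Cr (below pr e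
                (prime-∤-mono pr (r≢q ∘ prime-∣-prime pr (Descent-prime D)) (value e)
                  (subst (_ ∣.∣_) (Descent.split D) d)) a)
      ...   | yes r≡q with value-injective {v = r} {q} r≡q | Descent.at D
      ...     | refl | e′ , d′ , a′ = layer⁺ Cr (below pr e′
                (∣.*-cancelˡ-∣ (value q) {{nonZero q}}
                  (subst (_ ∣.∣_) (trans (Descent.split D) (ℕ.*-comm (value m) _)) d′)) a′)

      -- An inclusion between layers of the same size `N` is an equality, and a set has only one
      -- member of rank `i`.
      descent-prime-unique : Extensionality 0ℓ 0ℓ → ∀ {N i n q m n′ q′ m′} →
        Descent N i n q m → Descent N i n′ q′ m′ → layer n ⊑ layer n′ → q ≡ q′
      descent-prime-unique ext {n = n} {q} {n′ = n′} {q′} D D′ sub =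
        rank-injective (layer n) q q′ (Descent.member D) (subst (λ f → T (f q′)) (sym same) (Descent.member D′))
          (trans (Descent.index D) (sym (trans (cong (λ f → rank f q′) same) (Descent.index D′))))
        where
        same : layer n ≡ layer n′
        same = count-≡⇒≡ ext (value n) (value n′) sub (layer-bounded n) (layer-bounded n′)
          (trans (Descent.size D) (sym (Descent.size D′)))

      module _ (ext : Extensionality 0ℓ 0ℓ) (F : βℕ) (N i : ℕ) where

        Descends : Pred ℕ⁺ 0ℓ
        Descends n = ∃ λ q → ∃ λ m → Descent N i n q m

        cofactor : ℕ⁺ → ℕ⁺
        cofactor n with lem {Descends n}
        ... | yes (q , m , D) = m
        -- With `n` as the default, `cofactor-∣` holds for every `n`.
        ... | no  _           = n

        cofactor-Descent : ∀ {n} → Descends n → ∃ λ q → Descent N i n q (cofactor n)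
        cofactor-Descent {n} d with lem {Descends n}
        ... | yes (q , m , D) = q , D
        ... | no  ¬d          = ⊥-elim (¬d d)

        cofactor-∣ : ∀ n → cofactor n ∣ n
        cofactor-∣ n with lem {Descends n}
        ... | yes (q , m , D) = subst (value m ∣.∣_) (sym (Descent.split D)) (∣.m∣m*n (value q))
        ... | no  _           = ∣.∣-refl

        G : βℕ
        G = map-βℕ cofactor F

        module _ (F∋Descends : F ∋ Descends) where

          -- The upward closure of `Descends` separates F from G. If it contained the cofactor of
          -- some n in `Descends`, an n′ in `Descends` would divide that cofactor; n′ and n would
          -- share the prime q, and `At n′ q` would pass up to the cofactor, which misses the
          -- threshold.
          G<F : family G <∼ family F
          G<F = G∣F , λ (_ , F∣G) → absurd F∣G
            where
            G∣F : family G ∣̃ family F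
            G∣F A GA UA = βℕ.↑-closed F _ _ (λ n h → 𝒰-up UA (cofactor n) n h (cofactor-∣ n)) GA
            absurd : ¬ (family F ∣̃ family G)
            absurd F∣G with ∋-nonempty F F∋Descends
            ... | n₀ , d₀ with ∋-nonempty F (∋-∩ F {Descends} {S} F∋Descends F∋S)
              where
              S↑ : Pred ℕ⁺ 0ℓ
              S↑ n = ∃ λ n′ → Descends n′ × n′ ∣ n
              S : Pred ℕ⁺ 0ℓ
              S n = S↑ (cofactor n)
              F∋S↑ : F ∋ S↑
              F∋S↑ = ∋-mono F (λ n d → n , d , ∣.∣-refl) F∋Descends
              U : 𝒰 ⟦ S↑ ⟧
              U = 𝒰-⟦⟧ S↑ (n₀ , n₀ , d₀ , ∣.∣-refl)
                λ m n (n′ , d , n′∣m) m∣n → n′ , d , ∣.∣-trans n′∣m m∣n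
              F∋S : F ∋ S
              F∋S = ∋-mono F {T ∘ ⟦ S↑ ⟧ ∘ cofactor} (λ n → ⟦⟧⁻)
                (to (∋-T F (⟦ S↑ ⟧ ∘ cofactor)) (F∣G ⟦ S↑ ⟧ F∋S↑ U))
            ...   | n , d , n′ , d′ , n′∣m with cofactor-Descent d | cofactor-Descent d′
            ...     | q , D | q′ , D′
              with descent-prime-unique ext D′ D (layer-mono {n′} {n} (∣.∣-trans n′∣m (cofactor-∣ n)))
            ...       | refl = Descent.not-at D (At-mono {n′} {cofactor n} {q} n′∣m (Descent.at D′))

          -- If H is equivalent to neither side, some upward closed B is in H and not in G, and some
          -- E is in F and not in H. The number z found below is in B and not in E, while n′ is in E
          -- and the cofactor of n is not in B; so neither can n′ divide z nor z the cofactor of n.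
          nothing-between : ∀ H → ¬ (family G <∼ family H × family H <∼ family F)
          nothing-between H ((G∣H , G≠H) , (H∣F , H≠F))
            with lem {family H ∣̃ family G} | lem {family F ∣̃ family H}
          ... | yes H∣G | _ = G≠H (G∣H , H∣G)
          ... | no _ | yes F∣H = H≠F (H∣F , F∣H)
          ... | no ¬H∣G | no ¬F∣H with ∣̃-separate ¬H∣G | ∣̃-separate ¬F∣H
          ...   | B , HB , UB , ¬GB | E , FE , UE , ¬HE
            with ∋-nonempty H (∋-∩ H (∋-∩ H (to (∋-T H B) HB) (∋-∁ H ¬HE)) (∋-∩ H H∋↑ H∋↓))
            where
            S : Pred ℕ⁺ 0ℓ
            S n = Descends n × T (E n) × ¬ T (B (cofactor n))
            F∋S : F ∋ S
            F∋S = ∋-∩ F F∋Descends (∋-∩ F (to (∋-T F E) FE) (∋-∁ F ¬GB))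
            ↑S ↓S : Pred ℕ⁺ 0ℓ
            ↑S z = ∃ λ n → S n × cofactor n ∣ z
            ↓S z = ∃ λ n → S n × z ∣ n
            H∋↑ : H ∋ ↑S
            H∋↑ = G∣H ⟦ ↑S ⟧ (βℕ.↑-closed F _ _ (λ n s → ⟦⟧⁺ (n , ⟦⟧⁻ s , ∣.∣-refl)) F∋S)
              (let n , s = ∋-nonempty F F∋S in 𝒰-⟦⟧ ↑S (cofactor n , n , s , ∣.∣-refl)
                λ m n (n′ , s , d) m∣n → n′ , s , ∣.∣-trans d m∣n)
            -- Otherwise the complement of this downward closed set, being upward closed, would pass
            -- from H to F and meet `S`.
            H∋↓ : H ∋ ↓S
            H∋↓ with ∋-ultra H ↓S
            ... | inj₁ h = h
            ... | inj₂ h with ∋-nonempty F (∋-∩ F F∋S (H∣F _ h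
              (𝒰-⟦⟧ (λ z → ¬ ↓S z) (∋-nonempty H h)
                λ m n ¬s m∣n (n′ , s , d) → ¬s (n′ , s , ∣.∣-trans m∣n d))))
            ...   | n , s , ¬s = ⊥-elim (¬s (n , s , ∣.∣-refl))
          ...     | z , (Bz , ¬Ez) , (n′ , (d′ , En′ , _) , y∣z) , (n , (d , _ , ¬Bm) , z∣n)
            with cofactor-Descent d | cofactor-Descent d′
          ...       | q , D | q′ , D′
            -- The layer of n′ is included in that of its cofactor, which divides z, which divides
            -- n.
            with descent-prime-unique ext D′ D
                   (λ r → layer-mono (∣.∣-trans y∣z z∣n) r ∘ layer-descent D′ r)
          ...         | refl with lem {At z q}
          ...           | yes at = ¬Ez (𝒰-up UE n′ z En′
              (subst (λ k → k ∣.∣ value z) (sym (Descent.split D′))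
                (At-gain {cofactor n′} {z} {q} (Descent-prime D) y∣z at (Descent.not-at D′))))
          ...           | no ¬at with lem {z ∣ cofactor n}
          ...             | yes z∣m = ¬Bm (𝒰-up UB z (cofactor n) Bz z∣m)
          ...             | no z∤m = ¬at (At-cofactor {z} {n} {cofactor n} {q} (Descent-prime D) z∣n
              (Descent.split D) (Descent.at D) z∤m)

          G-ImmediatePredecessor : HasImmediatePredecessor F
          G-ImmediatePredecessor = G , G<F , nothing-between

      -- The size is at most `K` and the index is smaller still, so two uses of `∋-finite` fix both
      -- on a set in F.
      predecessor : Extensionality 0ℓ 0ℓ → ∀ F K →
        F ∋ (λ n → count (layer n) (value n) ℕ.≤ K) →
        F ∋ (λ n → ∃ λ N → ∃ λ i → ∃ λ q → ∃ λ m → Descent N i n q m) →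
        HasImmediatePredecessor F
      predecessor ext F K bound descends =
        let N , h = ∋-finite F (λ n N → ∃ λ i → ∃ λ q → ∃ λ m → i ℕ.≤ K × Descent N i n q m) K
                      (∋-mono F sizes (∋-∩ F bound descends))
            i , h′ = ∋-finite F (λ n i → ∃ λ q → ∃ λ m → Descent N i n q m) K
                       (∋-mono F (λ { n (i , q , m , i≤K , D) → i , i≤K , q , m , D }) h)
        in G-ImmediatePredecessor ext F N i h′
        where
        sizes : ∀ n → count (layer n) (value n) ℕ.≤ K × (∃ λ N → ∃ λ i → ∃ λ q → ∃ λ m → Descent N i n q m) →
                ∃ λ N → N ℕ.≤ K × (∃ λ i → ∃ λ q → ∃ λ m → i ℕ.≤ K × Descent N i n q m)
        sizes n (c≤K , N , i , q , m , D) =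
          N , subst (ℕ._≤ K) (Descent.size D) c≤K , i , q , m ,
          ℕ.<⇒≤ (ℕ.≤-trans (subst (ℕ._< count (layer n) (value n)) (Descent.index D)
            (rank-< (layer n) q (Descent.member D) (layer-bounded n q (Descent.member D)))) c≤K) , D

-- Transfer and saturation

-- The free variables are, in order, a set s, numbers x and b, the set of all numbers, the set of
-- all numbers and sets of numbers, and a relation R. The formula says that the numbers q in s are
-- those with (q , x , b) in R.
sectionSpec : Δ₀ 6
sectionSpec = all∈ 3F (conj (impl (0F ∊ 1F) Q) (impl Q (0F ∊ 1F)))
  where
  Q : Δ₀ 7
  Q = ex∈ 6F (tupleF 0F (1F ∷ 3F ∷ 4F ∷ []))

sectionBody : Δ₀ 5
sectionBody = ex∈ 3F (conj (all∈ 0F (0F ∊ 4F)) sectionSpec)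

∈-at : 𝒫 ℕ⁺ → Pred (Vector ℕ⁺ 1) 0ℓ
∈-at A v = T (A (v 0F))

module Extension (lem : ExcludedMiddle 0ℓ) (ext : Extensionality 0ℓ 0ℓ) (𝔑 : NonstandardExtension) where
  open NonstandardExtension 𝔑
  open Nonstandard lem 𝔑

  infix 4 _⊨Fm ⊨Fm*_

  _⊨Fm : Fm 0 → Set
  φ ⊨Fm = Sat id [] φ

  ⊨Fm*_ : Fm 0 → Set
  ⊨Fm* φ = Sat *Rel [] φ

  opaque
    transfer-Fm : (φ : Fm 0) → φ ⊨Fm → ⊨Fm* φ
    transfer-Fm φ h =
      to (bounded-correct lem *_ *Rel (λ R xs → ⇔.refl) φ (*_ ∘ ρ) zero suc (λ ()) [] *-ℕ
            (λ j → ≈-refl {v = * params lem φ j}) (λ ()))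
        (to (transfer (bounded φ zero suc λ ()) ρ)
          (from (bounded-correct lem id id (∈-relation lem ext) φ ρ zero suc (λ ()) []
                   (≈-refl {v = ρ zero}) (λ j → ≈-refl {v = params lem φ j}) (λ ())) h))
      where
      ρ : Vector (V ℕ⁺) (suc (#params φ))
      ρ = (set λ _ → true) ∷ params lem φ

  *-resp : ∀ {v w} → v ≈ w → * v ≈ * w
  *-resp {v} {w} = to (transfer (0F ≐ 1F) (v ∷ w ∷ []))

  -- A 1-tuple is its only entry, so the unary relation and the set `A` are equal in the
  -- superstructure, and so are their extensions.
  ∈-at-* : ∀ A x → *Rel (∈-at A) (x ∷ []) ⇔ T (tp x A)
  ∈-at-* A x = mk⇔
    (λ (z , z≈x , z∈R) → fromWitness (∈-respʳ {v = atom x} {* R} {* set A} R≈A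
        (∈-respˡ {v = atom x} {z} {* R} (≈-sym {v = z} z≈x) z∈R)))
    (λ x∈A → atom x , refl ,
      ∈-respʳ {v = atom x} {* set A} {* R} (≈-sym {v = * R} {* set A} R≈A) (toWitness {a? = lem} x∈A))
    where
    R : V ℕ⁺
    R = relation lem 0 (∈-at A)
    R≈A : * R ≈ * set A
    R≈A = *-resp {R} {set A}
      ( (λ n Rn → let xs , e , Axs = toWitness {a? = lem} Rn in n , subst (T ∘ A) (sym e) Axs , refl)
      , (λ n An → n , fromWitness ((n ∷ []) , refl , An) , refl))

  tp-ι : ∀ n A → T (tp (ι n) A) ⇔ T (A n)
  tp-ι n A = mk⇔
    (λ h → let m , Am , e = from n∈A (∈-respˡ {v = * atom n} {atom (ι n)} {* set A} (*-atom n)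
                              (toWitness {a? = lem} h))
           in subst (T ∘ A) (sym e) Am)
    (λ An → fromWitness (∈-respˡ {v = atom (ι n)} {* atom n} {* set A}
                (≈-sym {v = * atom n} {atom (ι n)} (*-atom n)) (to n∈A (n , An , refl))))
    where
    n∈A = transfer (0F ∊ 1F) (atom n ∷ set A ∷ [])

  opaque
    -- Comprehension over ℕ⁺ is a bounded sentence once the section is sought in `𝐏`. Its transfer,
    -- applied to the nonstandard `x` and `b`, finds the section in `* 𝐏`, whose members are
    -- internal by definition.
    section-internal : (Q : Pred (Vector ℕ⁺ 3) 0ℓ) (x b : *ℕ) →
      ∃ λ S → Internal S × (∀ v → v ∈ S ⇔ (∃ λ q → v ≈ atom q × *Rel Q (q ∷ x ∷ b ∷ [])))
    section-internal Q x b = S , (𝐏 , S∈P) , λ v → mk⇔ (fwd v) (bwd v)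
      where
      𝐍 𝐏 : V ℕ⁺
      𝐍 = set λ _ → true
      𝐏 = 2 , inj₂ λ _ → true

      ρ : Vector (V ℕ⁺) 3
      ρ = 𝐍 ∷ 𝐏 ∷ relation lem 2 Q ∷ []

      vs : Vector (Fin 8) 3
      vs = 1F ∷ 3F ∷ 4F ∷ []

      ∈*𝐍 : ∀ v → v ∈ * 𝐍 ⇔ (∃ λ q → v ≈ atom q)
      ∈*𝐍 v = mk⇔
        (λ v∈N → let q , _ , d = ∈-respʳ {v = v} {* 𝐍} {set λ _ → true} *-ℕ v∈N in q , d)
        (λ (q , d) → ∈-respʳ {v = v} {set λ _ → true} {* 𝐍} (≈-sym {v = * 𝐍} *-ℕ) (q , tt , d))

      standard : ρ ⊨Δ₀ all∈ 0F (all∈ 1F sectionBody)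
      standard vb (b , _ , db) vx (x , _ , dx) =
        s , s∈P , (λ y (q , _ , d) → q , tt , d) , λ vq (q , _ , dq) → fwd vq dq , bwd vq q dq
        where
        s : V ℕ⁺
        s = set λ q → ⌊ lem {Q (q ∷ x ∷ b ∷ [])} ⌋
        s∈P : s ∈ 𝐏
        s∈P = proj₂ s , tt , EqLevel-refl 1 (proj₂ s)
        ρ′ : V ℕ⁺ → V ℕ⁺ → Vector (V ℕ⁺) 8
        ρ′ z vq = z ∷ vq ∷ s ∷ vx ∷ vb ∷ ρ
        fwd : ∀ vq {q} → vq ≈ atom q → vq ∈ s → ∃ λ z → z ∈ relation lem 2 Q × (ρ′ z vq ⊨Δ₀ tupleF 0F vs)
        fwd vq dq (q , Qq , d) =
          let z , t , z∈R = to (∈-relation lem ext Q (q ∷ x ∷ b ∷ [])) (toWitness {a? = lem} Qq) in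
          z , z∈R , from (tupleF-correct lem {ρ = ρ′ z vq} 0F vs)
            (Tuple-resp {k = 2} {z} {z} {atom ∘ (q ∷ x ∷ b ∷ [])} {ρ′ z vq ∘ vs} (≈-refl {v = z})
              (λ { 0F → ≈-sym {v = vq} d ; 1F → ≈-sym {v = vx} dx ; 2F → ≈-sym {v = vb} db }) t)
        bwd : ∀ vq q → vq ≈ atom q → (∃ λ z → z ∈ relation lem 2 Q × (ρ′ z vq ⊨Δ₀ tupleF 0F vs)) → vq ∈ s
        bwd vq q dq (z , z∈R , t) =
          q , fromWitness (from (∈-relation lem ext Q (q ∷ x ∷ b ∷ []))
            ( z
            , Tuple-resp {k = 2} {z} {z} {ρ′ z vq ∘ vs} {atom ∘ (q ∷ x ∷ b ∷ [])} (≈-refl {v = z})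
                (λ { 0F → dq ; 1F → dx ; 2F → db }) (to (tupleF-correct lem {ρ = ρ′ z vq} 0F vs) t)
            , z∈R)) , dq

      nonstandard : atom x ∷ atom b ∷ *_ ∘ ρ ⊨Δ₀ sectionBody
      nonstandard = to (transfer (all∈ 0F (all∈ 1F sectionBody)) ρ) standard
        (atom b) (from (∈*𝐍 (atom b)) (b , refl))
                      (atom x) (from (∈*𝐍 (atom x)) (x , refl))

      S : V *ℕ
      S = proj₁ nonstandard

      S∈P : S ∈ * 𝐏
      S∈P = proj₁ (proj₂ nonstandard)

      S⊆N : ∀ v → v ∈ S → v ∈ * 𝐍
      S⊆N = proj₁ (proj₂ (proj₂ nonstandard))

      S-spec : S ∷ atom x ∷ atom b ∷ *_ ∘ ρ ⊨Δ₀ sectionSpec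
      S-spec = proj₂ (proj₂ (proj₂ nonstandard))

      ρ* : V *ℕ → V *ℕ → Vector (V *ℕ) 8
      ρ* z v = z ∷ v ∷ S ∷ atom x ∷ atom b ∷ *_ ∘ ρ

      fwd : ∀ v → v ∈ S → ∃ λ q → v ≈ atom q × *Rel Q (q ∷ x ∷ b ∷ [])
      fwd v v∈S with to (∈*𝐍 v) (S⊆N v v∈S) | proj₁ (S-spec v (S⊆N v v∈S)) v∈S
      ... | q , d | z , z∈R , t = q , d , z ,
           Tuple-resp {k = 2} {z} {z} {ρ* z v ∘ vs} {atom ∘ (q ∷ x ∷ b ∷ [])} (≈-refl {v = z})
             (λ { 0F → d ; 1F → refl ; 2F → refl }) (to (tupleF-correct lem {ρ = ρ* z v} 0F vs) t) ,
           z∈R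

      bwd : ∀ v → (∃ λ q → v ≈ atom q × *Rel Q (q ∷ x ∷ b ∷ [])) → v ∈ S
      bwd v (q , d , z , t , z∈R) = proj₂ (S-spec v (from (∈*𝐍 v) (q , d)))
        (z , z∈R , from (tupleF-correct lem {ρ = ρ* z v} 0F vs)
          (Tuple-resp {k = 2} {z} {z} {atom ∘ (q ∷ x ∷ b ∷ [])} {ρ* z v ∘ vs} (≈-refl {v = z})
            (λ { 0F → ≈-sym {v = v} d ; 1F → refl ; 2F → refl }) t))

-- Arithmetic of nonstandard powers and multiples

powR mulR : Pred (Vector ℕ⁺ 3) 0ℓ
powR v = value (v 0F) ℕ.^ value (v 1F) ≡ value (v 2F)
mulR v = value (v 0F) ℕ.* value (v 1F) ≡ value (v 2F)

ltR leR dvdR sucR : Pred (Vector ℕ⁺ 2) 0ℓ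
ltR v  = value (v 0F) ℕ.< value (v 1F)
leR v  = value (v 0F) ℕ.≤ value (v 1F)
dvdR v = v 0F ∣ v 1F
sucR v = suc (value (v 0F)) ≡ value (v 1F)

module Arithmetic (lem : ExcludedMiddle 0ℓ) (ext : Extensionality 0ℓ 0ℓ) (𝔑 : NonstandardExtension) where
  open NonstandardExtension 𝔑
  open Nonstandard lem 𝔑
  open Extension lem ext 𝔑
  open Standard lem

  sucR* : *ℕ → *ℕ → Set
  sucR* a c = *Rel sucR (a ∷ c ∷ [])

  rel-mono₂ : ∀ {R S : Pred (Vector ℕ⁺ 2) 0ℓ} → (∀ v → R v → S v) →
    ∀ x y → *Rel R (x ∷ y ∷ []) → *Rel S (x ∷ y ∷ [])
  rel-mono₂ {R} {S} h = transfer-Fm (all (all (impl (rel R σ) (rel S σ)))) λ x y → h _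
    where
    σ : Vector (Fin 2) 2
    σ = 1F ∷ 0F ∷ []

  rel-mono₃ : ∀ {R S : Pred (Vector ℕ⁺ 3) 0ℓ} → (∀ v → R v → S v) →
    ∀ x y z → *Rel R (x ∷ y ∷ z ∷ []) → *Rel S (x ∷ y ∷ z ∷ [])
  rel-mono₃ {R} {S} h = transfer-Fm (all (all (all (impl (rel R σ) (rel S σ))))) λ x y z → h _
    where
    σ : Vector (Fin 3) 3
    σ = 2F ∷ 1F ∷ 0F ∷ []

  pow-total : ∀ p a → ∃ λ y → p ^ a ≐* y
  pow-total = transfer-Fm (all (all (ex (rel powR (2F ∷ 1F ∷ 0F ∷ []))))) λ p a → p ^⁺ a , refl

  pow-functional : ∀ p a y z → p ^ a ≐* y → p ^ a ≐* z → y ≡ z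
  pow-functional = transfer-Fm
    (all (all (all (all (impl (rel powR (3F ∷ 2F ∷ 1F ∷ [])) (impl (rel powR (3F ∷ 2F ∷ 0F ∷ [])) (eq 1F 0F)))))))
    λ p a y z d e → value-injective (trans (sym d) e)

  suc-total : ∀ a → ∃ λ c → sucR* a c
  suc-total = transfer-Fm (all (ex (rel sucR (1F ∷ 0F ∷ [])))) λ a → suc⁺ a , refl

  suc⇒< : ∀ a c → sucR* a c → a <* c
  suc⇒< = rel-mono₂ λ v e → ℕ.≤-reflexive e

  suc-≤ : ∀ a c b → sucR* a c → a <* b → c ≤* b
  suc-≤ = transfer-Fm
    (all (all (all (impl (rel sucR (2F ∷ 1F ∷ [])) (impl (rel ltR (2F ∷ 0F ∷ [])) (rel leR (1F ∷ 0F ∷ [])))))))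
    λ a c b e a<b → subst (ℕ._≤ value b) e a<b

  <⇒≢ : ∀ a b → a <* b → ¬ a ≡ b
  <⇒≢ = transfer-Fm (all (all (impl (rel ltR (1F ∷ 0F ∷ [])) (neg (eq 1F 0F)))))
    λ { a b a<b refl → ℕ.<-irrefl refl a<b }

  <⇒≤ : ∀ a b → a <* b → a ≤* b
  <⇒≤ = rel-mono₂ λ v → ℕ.<⇒≤

  ≤-refl* : ∀ a → a ≤* a
  ≤-refl* = transfer-Fm (all (rel leR (0F ∷ 0F ∷ []))) λ a → ℕ.≤-refl

  <-trans* : ∀ a b c → a <* b → b <* c → a <* c
  <-trans* = transfer-Fm
    (all (all (all (impl (rel ltR (2F ∷ 1F ∷ [])) (impl (rel ltR (1F ∷ 0F ∷ [])) (rel ltR (2F ∷ 0F ∷ [])))))))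
    λ a b c → ℕ.<-trans

  ≮⇒≥ : ∀ a b → ¬ (a <* b) → b ≤* a
  ≮⇒≥ = transfer-Fm (all (all (impl (neg (rel ltR (1F ∷ 0F ∷ []))) (rel leR (0F ∷ 1F ∷ [])))))
    λ a b → ℕ.≮⇒≥

  ≤∧≢⇒< : ∀ a b → a ≤* b → ¬ a ≡ b → a <* b
  ≤∧≢⇒< = transfer-Fm (all (all (impl (rel leR (1F ∷ 0F ∷ [])) (impl (neg (eq 1F 0F)) (rel ltR (1F ∷ 0F ∷ []))))))
    λ a b a≤b a≢b → ℕ.≤∧≢⇒< a≤b (a≢b ∘ value-injective)

  pow-mono-∣ : ∀ p a b y z → p ^ a ≐* y → p ^ b ≐* z → a ≤* b → y ∣* z
  pow-mono-∣ = transfer-Fm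
    (all (all (all (all (all (impl (rel powR (4F ∷ 3F ∷ 1F ∷ [])) (impl (rel powR (4F ∷ 2F ∷ 0F ∷ []))
      (impl (rel leR (3F ∷ 2F ∷ [])) (rel dvdR (1F ∷ 0F ∷ []))))))))))
    λ p a b y z d e a≤b → subst (λ k → k ∣.∣ value z) d (subst (_ ∣.∣_) e (^-∣ (value p) a≤b))

  tp-mono : ∀ y z → y ∣* z → tp y ∣̃ tp z
  tp-mono y z y∣z A yA UA = to (∈-at-* A z) (transfer-Fm
    (all (all (impl (rel dvdR (1F ∷ 0F ∷ [])) (impl (rel (∈-at A) (1F ∷ [])) (rel (∈-at A) (0F ∷ []))))))
    (λ m n m∣n Am → 𝒰-up UA m n Am m∣n) y z y∣z (from (∈-at-* A y) yA))

  tp-pow : ∀ {p a b y z} → p ^ a ≐* y → p ^ b ≐* z → a ≤* b → tp y ∣̃ tp z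
  tp-pow {p} {a} {b} {y} {z} d e a≤b = tp-mono y z (pow-mono-∣ p a b y z d e a≤b)

  -- On the powers of a prime this raises the threshold exponent of an upward closed `A` by one.
  proper-multiples : 𝒫 ℕ⁺ → 𝒫 ℕ⁺
  proper-multiples A = ⟦ (λ n → ∃ λ m → T (A m) × m ∣ n × value m ≢ value n) ⟧

  proper-multiples-𝒰 : ∀ {A} → 𝒰 A → 𝒰 (proper-multiples A)
  proper-multiples-𝒰 {A} UA@((n , An) , _) = 𝒰-⟦⟧ _
    (n *⁺ two , n , An , ∣.m∣m*n 2 , λ e → ℕ.<-irrefl e (ℕ.m<m*n (value n) 2 {{nonZero n}} (s≤s (s≤s z≤n))))
    λ m k (l , Al , l∣m , l≢m) m∣k → l , Al , ∣.∣-trans l∣m m∣k ,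
      λ l≡k → l≢m (∣.∣-antisym l∣m (subst (value m ∣.∣_) (sym l≡k) m∣k))
    where
    two : ℕ⁺
    two = 2 , irr _

  proper-multiples-pow : ∀ {A p c b y z} → T (tp p ℙ) → p ^ c ≐* y → T (tp y A) → c <* b → p ^ b ≐* z →
    T (tp z (proper-multiples A))
  proper-multiples-pow {A} {p} {c} {b} {y} {z} pp d Ay c<b e = to (∈-at-* _ z) (transfer-Fm
    (all (all (all (all (all (impl (rel (∈-at ℙ) (4F ∷ [])) (impl (rel powR (4F ∷ 3F ∷ 1F ∷ []))
      (impl (rel (∈-at A) (1F ∷ [])) (impl (rel ltR (3F ∷ 2F ∷ [])) (impl (rel powR (4F ∷ 2F ∷ 0F ∷ []))
        (rel (∈-at (proper-multiples A)) (0F ∷ []))))))))))))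
    standard p c b y z (from (∈-at-* ℙ p) pp) d (from (∈-at-* A y) Ay) c<b e)
    where
    standard : ∀ p c b y z → T (ℙ p) → value p ℕ.^ value c ≡ value y → T (A y) → value c ℕ.< value b →
      value p ℕ.^ value b ≡ value z → T (proper-multiples A z)
    standard p c b y z pp d Ay c<b e = ⟦⟧⁺ (y , Ay ,
      subst (λ k → k ∣.∣ value z) d (subst (_ ∣.∣_) e (^-∣ (value p) (ℕ.<⇒≤ c<b))) ,
      λ y≡z → ℕ.<-irrefl (trans d (trans y≡z (sym e)))
        (ℕ.^-monoʳ-< (value p) (ℕ.nonTrivial⇒n>1 _ {{prime⇒nonTrivial (prime-ℙ {p} pp)}}) c<b))

  proper-multiples-pred : ∀ {A p a c y y′} → 𝒰 A → T (tp p ℙ) → sucR* a c → p ^ a ≐* y → p ^ c ≐* y′ →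
    T (tp y′ (proper-multiples A)) → T (tp y A)
  proper-multiples-pred {A} {p} {a} {c} {y} {y′} UA pp s d e A₂y′ = to (∈-at-* A y) (transfer-Fm
    (all (all (all (all (all (impl (rel (∈-at ℙ) (4F ∷ [])) (impl (rel sucR (3F ∷ 2F ∷ []))
      (impl (rel powR (4F ∷ 3F ∷ 1F ∷ [])) (impl (rel powR (4F ∷ 2F ∷ 0F ∷ []))
        (impl (rel (∈-at (proper-multiples A)) (0F ∷ [])) (rel (∈-at A) (1F ∷ []))))))))))))
    standard p a c y y′ (from (∈-at-* ℙ p) pp) s d e (from (∈-at-* _ y′) A₂y′))
    where
    standard : ∀ p a c y y′ → T (ℙ p) → suc (value a) ≡ value c → value p ℕ.^ value a ≡ value y →
      value p ℕ.^ value c ≡ value y′ → T (proper-multiples A y′) → T (A y)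
    standard p a c y y′ pp s d e h with ⟦⟧⁻ h
    ... | m , Am , m∣y′ , m≢y′ = 𝒰-up UA m y Am (subst (value m ∣.∣_) d
      (prime-power-divisor (value a) (prime-ℙ {p} pp)
        (subst (value m ∣.∣_) (sym e′) m∣y′) (λ m≡ → m≢y′ (trans m≡ e′))))
      where
      e′ : value p ℕ.^ suc (value a) ≡ value y′
      e′ = trans (cong (value p ℕ.^_) s) e

  -- Layers at a nonstandard number

  module _ {A : 𝒫 ℕ⁺} (UA : 𝒰 A) where
    open Layers A (𝒰-up UA)

    -- What x tells about F is which standard sets have x in their extension, so the size, index,
    -- prime and cofactor are quantified inside one such set.
    Drops : 𝒫 ℕ⁺ → Pred ℕ⁺ 0ℓ
    Drops C n = ∃ λ N → ∃ λ i → ∃ λ q → ∃ λ m → Descent C N i n q m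

    Drops* : ∀ {C p a c y y′ x′ x} → T (tp p ℙ) → T (tp p C) → sucR* a c → p ^ a ≐* y → p ^ c ≐* y′ →
      y′ · x′ ≐* x → ¬ (p ∣* x′) → ¬ T (tp y A) → T (tp y′ A) → T (tp x ⟦ Drops C ⟧)
    Drops* {C} {p} {a} {c} {y} {y′} {x′} {x} pp Cp s d d′ e p∤x′ ¬Ay Ay′ = to (∈-at-* _ x) (transfer-Fm
      (all (all (all (all (all (all (all
        (impl (rel (∈-at ℙ) (6F ∷ [])) (impl (rel (∈-at C) (6F ∷ [])) (impl (rel sucR (5F ∷ 4F ∷ []))
        (impl (rel powR (6F ∷ 5F ∷ 3F ∷ [])) (impl (rel powR (6F ∷ 4F ∷ 2F ∷ []))
        (impl (rel mulR (2F ∷ 1F ∷ 0F ∷ [])) (impl (neg (rel dvdR (6F ∷ 1F ∷ [])))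
        (impl (neg (rel (∈-at A) (3F ∷ []))) (impl (rel (∈-at A) (2F ∷ []))
        (rel (∈-at ⟦ Drops C ⟧) (0F ∷ []))))))))))))))))))
      standard p a c y y′ x′ x (from (∈-at-* ℙ p) pp) (from (∈-at-* C p) Cp) s d d′ e p∤x′
        (¬Ay ∘ to (∈-at-* A y)) (from (∈-at-* A y′) Ay′))
      where
      standard : ∀ p a c y y′ x′ n → T (ℙ p) → T (C p) → suc (value a) ≡ value c →
        value p ℕ.^ value a ≡ value y → value p ℕ.^ value c ≡ value y′ →
        value y′ ℕ.* value x′ ≡ value n → ¬ (p ∣ x′) → ¬ T (A y) → T (A y′) → T (⟦ Drops C ⟧ n)
      -- The cofactor is pᵃ x′. The size and the index are whatever they are for `n`.
      standard p a c y y′ x′ n pp Cp s d d′ e p∤x′ ¬Ay Ay′ = ⟦⟧⁺ (_ , _ , p , y *⁺ x′ ,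
        descent split
          (layer⁺ C Cp (below (prime-ℙ {p} pp) a (∣.∣-trans (^-∣ (value p) (ℕ.n≤1+n (value a))) pᶜ∣n) Apᶜ))
          refl refl (a , pᶜ∣n , Apᶜ) not-at)
        where
        pᶜ≡y′ : p ^⁺ suc⁺ a ≡ y′
        pᶜ≡y′ = value-injective (trans (cong (value p ℕ.^_) s) d′)
        pᶜ∣n : p ^⁺ suc⁺ a ∣ n
        pᶜ∣n = subst (_∣ n) (sym pᶜ≡y′) (∣.divides (value x′) (trans (sym e) (ℕ.*-comm (value y′) (value x′))))
        Apᶜ : T (A (p ^⁺ suc⁺ a))
        Apᶜ = subst (T ∘ A) (sym pᶜ≡y′) Ay′
        split : value n ≡ value y ℕ.* value x′ ℕ.* value p
        split = trans (sym e) (trans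
          (cong (ℕ._* value x′) (trans (sym (cong value pᶜ≡y′)) (cong (value p ℕ.*_) d)))
          (trans (ℕ.*-assoc (value p) (value y) (value x′)) (ℕ.*-comm (value p) _)))
        not-at : ¬ At (y *⁺ x′) p
        not-at (f , pᶠ∣ , Apᶠ) = ¬Ay (𝒰-up UA _ y Apᶠ
          (prime-∤-mono (prime-ℙ {p} pp) p∤x′ (suc (value f)) pᶠ∣))

    belowR : Pred (Vector ℕ⁺ 2) 0ℓ
    belowR v = Below (v 0F) (v 1F)

    -- Patterns count exact powers only. The exact exponent is at least the one given by `Below`,
    -- and upward closure keeps the next power in `A`.
    Below*-exact : ∀ x q → *Rel belowR (x ∷ q ∷ []) →
      ∃ λ e → ExactlyDivides q e x × (∀ f z → sucR* e f → q ^ f ≐* z → T (tp z A))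
    Below*-exact x q = repack ∘ transfer-Fm
      (all (all (impl (rel belowR (1F ∷ 0F ∷ [])) (ex (ex (ex
        (conj (rel powR (3F ∷ 2F ∷ 1F ∷ [])) (conj (rel mulR (1F ∷ 0F ∷ 4F ∷ []))
        (conj (neg (rel dvdR (3F ∷ 0F ∷ [])))
        (all (all (impl (rel sucR (4F ∷ 1F ∷ [])) (impl (rel powR (5F ∷ 1F ∷ 0F ∷ []))
          (rel (∈-at A) (0F ∷ []))))))))))))))) standard x q
      where
      repack : (∃ λ e → ∃ λ y → ∃ λ x′ → q ^ e ≐* y × y · x′ ≐* x × ¬ (q ∣* x′) ×
                 (∀ f z → sucR* e f → q ^ f ≐* z → *Rel (∈-at A) (z ∷ []))) →
               ∃ λ e → ExactlyDivides q e x × (∀ f z → sucR* e f → q ^ f ≐* z → T (tp z A))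
      repack (e , y , x′ , d , m , q∤x′ , up) =
        e , (y , x′ , d , m , q∤x′) , λ f z s p → to (∈-at-* A z) (up f z s p)
      standard : ∀ n q → Below n q → ∃ λ e → ∃ λ y → ∃ λ x′ →
        value q ℕ.^ value e ≡ value y × value y ℕ.* value x′ ≡ value n × ¬ (q ∣ x′) ×
        (∀ f z → suc (value e) ≡ value f → value q ℕ.^ value f ≡ value z → T (A z))
      standard n q (below pq e₀ d a) with prime-exact-power pq (nonZero n) (value e₀) d
      ... | zero , e₀≤0 , _ = ⊥-elim (ℕ.≢-nonZero⁻¹ (value e₀) {{nonZero e₀}} (ℕ.n≤0⇒n≡0 e₀≤0))
      ... | e@(suc _) , e₀≤e , zero , m , _ = ⊥-elim (ℕ.≢-nonZero⁻¹ (value n) {{nonZero n}}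
              (trans (sym m) (ℕ.*-zeroʳ (value q ℕ.^ e))))
      ... | e@(suc _) , e₀≤e , x@(suc _) , m , q∤x =
        (e , irr _) , q ^⁺ (e , irr _) , (x , irr _) , refl , m , q∤x ,
        λ f z s p → 𝒰-up UA _ z a (subst (_ ∣.∣_) p (^-∣ (value q) (subst (suc (value e₀) ℕ.≤_) s (s≤s e₀≤e))))

    -- The second number is a bound and need not belong to the layer: `rank` counts the members
    -- strictly below it.
    CountR : 𝒫 ℕ⁺ → ℕ → Pred (Vector ℕ⁺ 2) 0ℓ
    CountR C k v = k ℕ.≤ rank (layer C (v 0F)) (v 1F)

    PickR : ℕ → 𝒫 ℕ⁺ → Pred (Vector ℕ⁺ 3) 0ℓ
    PickR k C v = value (v 0F) ℕ.< value (v 2F) × T (layer C (v 1F) (v 0F)) × k ℕ.≤ rank (layer C (v 1F)) (v 0F)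

    pick* : ∀ C k x b → *Rel (CountR C (suc k)) (x ∷ b ∷ []) → ∃ λ q → *Rel (PickR k C) (q ∷ x ∷ b ∷ [])
    pick* C k = transfer-Fm
      (all (all (impl (rel (CountR C (suc k)) (1F ∷ 0F ∷ [])) (ex (rel (PickR k C) (0F ∷ 2F ∷ 1F ∷ []))))))
      λ n b h → let q , Tq , q≤b , k≤ = count-pick (layer C n) (ℕ.pred (value b)) h in
        q , subst (suc (value q) ℕ.≤_) (ℕ.suc-pred (value b) {{nonZero b}}) (s≤s q≤b) , Tq , k≤

    -- As `rank` is strict, the bound that catches everything up to x is x + 1.
    count* : ∀ C k x b → sucR* x b → ¬ T (tp x ⟦ (λ n → count (layer C n) (value n) ℕ.≤ k) ⟧) →
      *Rel (CountR C (suc k)) (x ∷ b ∷ [])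
    count* C k x b s h = transfer-Fm
      (all (all (impl (rel sucR (1F ∷ 0F ∷ [])) (impl (neg (rel (∈-at ⟦ S ⟧) (1F ∷ [])))
        (rel (CountR C (suc k)) (1F ∷ 0F ∷ []))))))
      (λ n b s ¬s → subst (suc k ℕ.≤_) (cong (count (layer C n) ∘ ℕ.pred) s) (ℕ.≰⇒> (¬s ∘ ⟦⟧⁺)))
      x b s (h ∘ to (∈-at-* ⟦ S ⟧ x))
      where
      S : Pred ℕ⁺ 0ℓ
      S n = count (layer C n) (value n) ℕ.≤ k

    layer-⊑ : ∀ {C C′} → C ⊑ C′ → ∀ n → layer C n ⊑ layer C′ n
    layer-⊑ {C} {C′} sub n q h = let c , b = layer⁻ C h in layer⁺ C′ (sub q c) b

    PickR-mono : ∀ k {C C′} → C ⊑ C′ → ∀ v → PickR k C v → PickR k C′ v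
    PickR-mono k {C} {C′} sub v (lt , t , le) = lt , layer-⊑ {C} {C′} sub (v 1F) (v 0F) t ,
      ℕ.≤-trans le (count-⊑ (layer-⊑ {C} {C′} sub (v 1F)) (ℕ.pred (value (v 0F))))

    PickR*-< : ∀ k C q x b → *Rel (PickR k C) (q ∷ x ∷ b ∷ []) → q <* b
    PickR*-< k C = transfer-Fm
      (all (all (all (impl (rel (PickR k C) (2F ∷ 1F ∷ 0F ∷ [])) (rel ltR (2F ∷ 0F ∷ []))))))
      λ q n b → proj₁

    PickR*-Below : ∀ k C q x b → *Rel (PickR k C) (q ∷ x ∷ b ∷ []) → *Rel belowR (x ∷ q ∷ [])
    PickR*-Below k C = transfer-Fm
      (all (all (all (impl (rel (PickR k C) (2F ∷ 1F ∷ 0F ∷ [])) (rel belowR (1F ∷ 2F ∷ []))))))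
      λ q n b (_ , t , _) → proj₂ (layer⁻ C t)

    PickR*-count : ∀ k C q x b → *Rel (PickR k C) (q ∷ x ∷ b ∷ []) → *Rel (CountR C k) (x ∷ q ∷ [])
    PickR*-count k C = transfer-Fm
      (all (all (all (impl (rel (PickR k C) (2F ∷ 1F ∷ 0F ∷ [])) (rel (CountR C k) (1F ∷ 2F ∷ []))))))
      λ q n b (_ , _ , le) → le

    PickR-∈ : ∀ k C v → PickR k C v → T (C (v 0F))
    PickR-∈ k C v (_ , t , _) = proj₁ (layer⁻ C t)

  -- Generators from saturation

  full-∈ : ∀ P → T (family P λ _ → true)
  full-∈ P with βℕ.ultra P (λ _ → true)
  ... | inj₁ h = h
  ... | inj₂ h = ⊥-elim (βℕ.∅-∉ P h)

  -- A set outside `P` has its complement in `P`, and q cannot lie in both extensions.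
  ⊨-intro : ∀ {q} (P : βℕ) → (∀ C → T (family P C) → T (tp q C)) → q ⊨ P
  ⊨-intro {q} P h A = T-≡ in-P (h A)
    where
    in-P : T (tp q A) → T (family P A)
    in-P qA with βℕ.ultra P A
    ... | inj₁ PA = PA
    ... | inj₂ P¬A = ⊥-elim (transfer-Fm
      (all (impl (rel (∈-at A) (0F ∷ [])) (neg (rel (∈-at (not ∘ A)) (0F ∷ [])))))
      (λ n An ¬An → subst T (to T-not-≡ ¬An) An) q
      (from (∈-at-* A q) qA) (from (∈-at-* (not ∘ A) q) (h _ P¬A)))

  opaque
    -- Each `Q C` cuts out an internal set, and by monotonicity finitely many of these conditions
    -- follow from the one for an intersection. There are at most 𝔠 sets C, so saturation applies;
    -- as `Q C` puts q into the extension of C, the solution generates `P`.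
    realize : 𝔠⁺-Saturated 𝔑 → (P : βℕ) (Q : 𝒫 ℕ⁺ → Pred (Vector ℕ⁺ 3) 0ℓ) →
      (∀ {C C′} → C ⊑ C′ → ∀ v → Q C v → Q C′ v) → (∀ C v → Q C v → T (C (v 0F))) → ∀ x b →
      (∀ C → T (family P C) → ∃ λ q → *Rel (Q C) (q ∷ x ∷ b ∷ [])) →
      ∃ λ q → q ⊨ P × (∀ C → T (family P C) → *Rel (Q C) (q ∷ x ∷ b ∷ []))
    realize sat P Q Q-mono Q-∈ x b h = q , ⊨-intro P q∈* , q-spec
      where
      decode : (ℕ → Bool) → 𝒫 ℕ⁺
      -- Saturation takes a family indexed by all sequences. Those that code no set of `P` are sent
      -- to ℕ⁺, which belongs to `P`.
      decode i = if family P (i ∘ value) then i ∘ value else λ _ → true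

      decode-∈ : ∀ i → T (family P (decode i))
      decode-∈ i with family P (i ∘ value) in eq
      ... | true  = subst T (sym eq) tt
      ... | false = full-∈ P

      encode : 𝒫 ℕ⁺ → ℕ → Bool
      encode C zero    = false
      encode C (suc n) = C (suc n , irr _)

      decode-encode : ∀ C → T (family P C) → decode (encode C) ≡ C
      decode-encode C PC =
        trans (cong (λ D → if family P D then D else λ _ → true) (ext encode-value)) if-true
        where
        encode-value : ∀ n → encode C (value n) ≡ C n
        encode-value (zero  , irr p) = ⊥-elim-irr (ℕ.≢-nonZero⁻¹ 0 {{p}} refl)
        encode-value (suc n , _)     = refl
        if-true : (if family P C then C else λ _ → true) ≡ C
        if-true with family P C
        ... | true = refl

      S : (ℕ → Bool) → V *ℕ
      S i = proj₁ (section-internal (Q (decode i)) x b)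

      S-spec : ∀ i v → v ∈ S i ⇔ (∃ λ q → v ≈ atom q × *Rel (Q (decode i)) (q ∷ x ∷ b ∷ []))
      S-spec i = proj₂ (proj₂ (section-internal (Q (decode i)) x b))

      common : (is : List (ℕ → Bool)) → ∃ λ C → T (family P C) × All (λ i → C ⊑ decode i) is
      common List.[] = (λ _ → true) , full-∈ P , All.[]
      common (i List.∷ is) = let C , PC , subs = common is in
        (λ n → decode i n ∧ C n) , βℕ.∩-closed P _ _ (decode-∈ i) PC ,
        (λ n → proj₁ ∘ to (T-∧ {decode i n})) All.∷
        All.map (λ sub n → sub n ∘ proj₂ ∘ to (T-∧ {decode i n})) subs

      finite : ∀ is → ∃ λ v → All (λ i → v ∈ S i) is
      finite is = let C , PC , subs = common is
                      q , Qq = h C PC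
                  in atom q , All.map (λ {i} sub →
                       from (S-spec i (atom q)) (q , refl , rel-mono₃ (Q-mono sub) q x b Qq)) subs

      v : V *ℕ
      v = proj₁ (sat S (λ i → proj₁ (proj₂ (section-internal (Q (decode i)) x b))) finite)
      v∈S : ∀ i → v ∈ S i
      v∈S = proj₂ (sat S (λ i → proj₁ (proj₂ (section-internal (Q (decode i)) x b))) finite)

      member₀ : ∃ λ q → v ≈ atom q × *Rel (Q (decode λ _ → true)) (q ∷ x ∷ b ∷ [])
      member₀ = to (S-spec (λ _ → true) v) (v∈S _)

      q : *ℕ
      q = proj₁ member₀

      q-spec : ∀ C → T (family P C) → *Rel (Q C) (q ∷ x ∷ b ∷ [])
      q-spec C PC = subst (λ D → *Rel (Q D) (q ∷ x ∷ b ∷ [])) (decode-encode C PC)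
        (same (to (S-spec (encode C) v) (v∈S (encode C))))
        where
        same : (∃ λ q′ → v ≈ atom q′ × *Rel (Q (decode (encode C))) (q′ ∷ x ∷ b ∷ [])) →
               *Rel (Q (decode (encode C))) (q ∷ x ∷ b ∷ [])
        same (q′ , v≈q′ , Qq′) = subst (λ r → *Rel (Q (decode (encode C))) (r ∷ x ∷ b ∷ []))
          (≈-trans {u = atom q′} {v} {atom q} (≈-sym {v = v} v≈q′) (proj₁ (proj₂ member₀))) Qq′

      q∈* : ∀ C → T (family P C) → T (tp q C)
      q∈* C PC = to (∈-at-* C q) (transfer-Fm
        (all (all (all (impl (rel (Q C) (2F ∷ 1F ∷ 0F ∷ [])) (rel (∈-at C) (2F ∷ []))))))
        (λ q x b → Q-∈ C _) q x b (q-spec C PC))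

  module _ {A : 𝒫 ℕ⁺} (UA : 𝒰 A) where
    open Layers A (𝒰-up UA)

    -- Saturation yields a generator q that has, for all C in `P` at once, k members of the layer of
    -- C below it. This is the hypothesis of the next round with bound q, so the generators decrease
    -- and are distinct.
    chain : 𝔠⁺-Saturated 𝔑 → (P : βℕ) → ∀ k x b →
      (∀ C → T (family P C) → *Rel (CountR UA C k) (x ∷ b ∷ [])) →
      ∃ λ (qs : Vector *ℕ k) → (∀ i → qs i ⊨ P × *Rel (belowR UA) (x ∷ qs i ∷ []) × qs i <* b) ×
                               (∀ i j → qs i ≡ qs j → i ≡ j)
    chain sat P zero x b h = (λ ()) , (λ ()) , (λ ())
    chain sat P (suc k) x b h = extend
      (realize sat P (PickR UA k) (PickR-mono UA k) (PickR-∈ UA k) x b (λ C PC → pick* UA C k x b (h C PC)))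
      where
      extend : (∃ λ q → q ⊨ P × (∀ C → T (family P C) → *Rel (PickR UA k C) (q ∷ x ∷ b ∷ []))) →
        ∃ λ (qs : Vector *ℕ (suc k)) → (∀ i → qs i ⊨ P × *Rel (belowR UA) (x ∷ qs i ∷ []) × qs i <* b) ×
                                       (∀ i j → qs i ≡ qs j → i ≡ j)
      extend (q , q⊨P , picked) = add (chain sat P k x q (λ C PC → PickR*-count UA k C q x b (picked C PC)))
        where
        q<b : q <* b
        q<b = PickR*-< UA k _ q x b (picked _ (full-∈ P))
        add : (∃ λ (qs : Vector *ℕ k) → (∀ i → qs i ⊨ P × *Rel (belowR UA) (x ∷ qs i ∷ []) × qs i <* q) ×
                                         (∀ i j → qs i ≡ qs j → i ≡ j)) →
          ∃ λ (qs : Vector *ℕ (suc k)) → (∀ i → qs i ⊨ P × *Rel (belowR UA) (x ∷ qs i ∷ []) × qs i <* b) ×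
                                         (∀ i j → qs i ≡ qs j → i ≡ j)
        add (qs , props , injective) = q ∷ qs , props′ , injective′
          where
          props′ : ∀ i → (q ∷ qs) i ⊨ P × *Rel (belowR UA) (x ∷ (q ∷ qs) i ∷ []) × (q ∷ qs) i <* b
          props′ zero    = q⊨P , PickR*-Below UA k _ q x b (picked _ (full-∈ P)) , q<b
          props′ (suc i) = let m , l , lt = props i in m , l , <-trans* (qs i) q b lt q<b
          injective′ : ∀ i j → (q ∷ qs) i ≡ (q ∷ qs) j → i ≡ j
          injective′ zero    zero    e = refl
          injective′ zero    (suc j) e = ⊥-elim (<⇒≢ (qs j) q (proj₂ (proj₂ (props j))) (sym e))
          injective′ (suc i) zero    e = ⊥-elim (<⇒≢ (qs i) q (proj₂ (proj₂ (props i))) e)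
          injective′ (suc i) (suc j) e = cong suc (injective i j e)

-- Basic classes, partial sums and exponents in a class of the first kind

≤∞[] : ∀ {t k} → t ≤∞ [ k ] → ∃ λ n → t ≡ [ n ] × n ℕ.≤ k
≤∞[] NonStrict.[ n≤k ] = _ , refl , n≤k

∣̃-trans : ∀ {X Y Z} → X ∣̃ Y → Y ∣̃ Z → X ∣̃ Z
∣̃-trans h k A XA UA = k A (h A XA UA) UA

=∼-sym : ∀ {X Y} → X =∼ Y → Y =∼ X
=∼-sym (h , k) = k , h

=∼-trans : ∀ {X Y Z} → X =∼ Y → Y =∼ Z → X =∼ Z
=∼-trans (h , k) (h′ , k′) = ∣̃-trans h h′ , ∣̃-trans k′ k

module BasicClasses (lem : ExcludedMiddle 0ℓ) (ext : Extensionality 0ℓ 0ℓ) (𝔑 : NonstandardExtension) where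
  open NonstandardExtension 𝔑
  open Nonstandard lem 𝔑
  open Extension lem ext 𝔑
  open Standard lem
  open Arithmetic lem ext 𝔑

  tp^ : *ℕ → *ℕ → 𝒫 (𝒫 ℕ⁺)
  tp^ p a = tp (proj₁ (pow-total p a))

  tp^-mono : ∀ {p a b} → a ≤* b → tp^ p a ∣̃ tp^ p b
  tp^-mono {p} {a} {b} = tp-pow (proj₂ (pow-total p a)) (proj₂ (pow-total p b))

  tp^-≡ : ∀ {p a y} → p ^ a ≐* y → tp^ p a ≡ tp y
  tp^-≡ {p} {a} d = cong tp (pow-functional p a _ _ (proj₂ (pow-total p a)) d)

  -- HasCardinality S ⊤⁺ quantifies over the nonstandard z, and so would be
  -- vacuous if there were none.
  inhabited : ∀ {S : Pred (*ℕ × *ℕ) 0ℓ} {c} → (∃ λ z → ∀ n → z ≢ ι n) → HasCardinality S c →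
    [ 0 ] <∞ c → ∃ S
  inhabited {c = [ suc n ]} _ inv _ = Inverse.from inv zero
  inhabited {c = [ zero ]} _ inv Strict.[ () ]
  inhabited {c = ⊤⁺} (z , z≢ι) inv _ = Inverse.from (inv z z≢ι) (z , ≤-refl* z)

  module _ {P : P̄} where

    tpᴱ : 𝓔 P → 𝒫 (𝒫 ℕ⁺)
    tpᴱ u = tp^ (𝓔.p u) (𝓔.a u)

    ≈ᴱ⇒ : (u v : 𝓔 P) → u ≈ᴱ v → tpᴱ u =∼ tpᴱ v
    ≈ᴱ⇒ u v (y , z , d , e , h) = subst₂ _=∼_ (sym (tp^-≡ d)) (sym (tp^-≡ e)) h

    ⇒≈ᴱ : (u v : 𝓔 P) → tpᴱ u =∼ tpᴱ v → u ≈ᴱ v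
    ⇒≈ᴱ u v h = _ , _ , proj₂ (pow-total _ _) , proj₂ (pow-total _ _) , h

    ≈ᴱ-refl : (u : 𝓔 P) → u ≈ᴱ u
    ≈ᴱ-refl u = ⇒≈ᴱ u u ((λ A h _ → h) , (λ A h _ → h))

    ≈ᴱ-sym : (u v : 𝓔 P) → u ≈ᴱ v → v ≈ᴱ u
    ≈ᴱ-sym u v h = ⇒≈ᴱ v u (=∼-sym (≈ᴱ⇒ u v h))

    ≈ᴱ-trans : (u v w : 𝓔 P) → u ≈ᴱ v → v ≈ᴱ w → u ≈ᴱ w
    ≈ᴱ-trans u v w h k = ⇒≈ᴱ u w (=∼-trans (≈ᴱ⇒ u v h) (≈ᴱ⇒ v w k))

    Fibre : *ℕ → 𝓔 P → Pred (*ℕ × *ℕ) 0ℓ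
    Fibre x w (p , a) = (p , a) ∈ᴱ w × ExactlyDivides p a x

    Fibre-resp : ∀ {x} {w w′ : 𝓔 P} → w ≈ᴱ w′ → ∀ pa → Fibre x w pa → Fibre x w′ pa
    Fibre-resp {w = w} {w′} h (p , a) ((p⊨P , m) , d) = (p⊨P , ≈ᴱ-trans ⟨ p , p⊨P , a ⟩ w w′ m h) , d

    -- Partial sums in `IsSum` run over pairwise inequivalent classes, whereas several `w i` may lie
    -- in one class.
    representatives : (Q : Pred (𝓔 P) 0ℓ) → ∀ m (w : Vector (𝓔 P) m) → (∀ i → Q (w i)) →
      ∃ λ xs → All Q xs × AllPairs (λ x y → ¬ (x ≈ᴱ y)) xs × (∀ i → Any (w i ≈ᴱ_) xs)
    representatives Q zero w h = List.[] , All.[] , AllPairs.[] , λ ()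
    representatives Q (suc m) w h with representatives Q m (w ∘ suc) (h ∘ suc)
    ... | xs , Qxs , distinct , covers with lem {Any (w zero ≈ᴱ_) xs}
    ...   | yes found = xs , Qxs , distinct , λ { zero → found ; (suc i) → covers i }
    ...   | no ¬found = w zero List.∷ xs , h zero All.∷ Qxs , ¬Any⇒All¬ xs ¬found AllPairs.∷ distinct ,
            λ { zero → here (≈ᴱ-refl (w zero)) ; (suc i) → there (covers i) }

    -- An infinite summand would make the total infinite, so every fibre comes with a finite
    -- numbering, and the numberings are concatenated.
    enumerate : ∀ {x} (f : 𝓔 P → ℕ∞) → (∀ w → HasCardinality (Fibre x w) (f w)) →
      ∀ xs n → List.foldr _+∞_ [ 0 ] (List.map f xs) ≡ [ n ] →
      ∃ λ L → List.length L ≡ n × (∀ w pa → Fibre x w pa → Any (w ≈ᴱ_) xs → pa ∈ₗ L)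
    enumerate f card List.[] .0 refl = List.[] , refl , λ _ _ _ ()
    enumerate {x} f card (v List.∷ xs) n e with f v | card v | List.foldr _+∞_ [ 0 ] (List.map f xs) in eq
    enumerate {x} f card (v List.∷ xs) .(k ℕ.+ l) refl | [ k ] | inv | [ l ] with enumerate {x} f card xs l eq
    ... | L , len , covers = List.tabulate pair List.++ L ,
            trans (length-++ (List.tabulate pair)) (cong₂ ℕ._+_ (length-tabulate pair) len) , covers′
      where
      pair : Fin k → *ℕ × *ℕ
      pair i = proj₁ (Inverse.from inv i)
      covers′ : ∀ w pa → Fibre x w pa → Any (w ≈ᴱ_) (v List.∷ xs) → pa ∈ₗ (List.tabulate pair List.++ L)
      covers′ w pa d (there i) = ∈-++⁺ʳ _ (covers w pa d i)
      covers′ w pa d (here w≈v) = ∈-++⁺ˡ (subst (_∈ₗ List.tabulate pair) (Inverse.strictlyInverseʳ inv s)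
                                     (∈-tabulate⁺ (Inverse.to inv s)))
        where
        s : ∃ (Fibre x v)
        s = pa , Fibre-resp {x} {w} {v} w≈v pa d

    -- The partial sum over the classes of the `w i` is at most `K` and lists all their pairs, so
    -- two of the K + 1 pairs share a place in the list and hence a prime.
    sum-bound : ∀ {x} (Q : Pred (𝓔 P) 0ℓ) (f : 𝓔 P → ℕ∞) → (∀ w → HasCardinality (Fibre x w) (f w)) →
      ∀ K → IsSum _≈ᴱ_ Q f [ K ] →
      (w : Vector (𝓔 P) (suc K)) → (∀ i → Q (w i)) → (∀ i → ExactlyDivides (𝓔.p (w i)) (𝓔.a (w i)) x) →
      (∀ i j → 𝓔.p (w i) ≡ 𝓔.p (w j) → i ≡ j) → ⊥
    sum-bound {x} Q f card K (bounded , _) w Qw divides injective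
      with representatives Q (suc K) w Qw
    ... | xs , Qxs , distinct , covers with ≤∞[] (bounded _ (xs , Qxs , distinct , refl))
    ...   | n , e , n≤K with enumerate {x} f card xs n e
    ...     | L , refl , complete =
      let i , j , i<j , same = Fin.pigeonhole (s≤s n≤K) (Any.index ∘ found)
      in Fin.<⇒≢ i<j (injective i j (cong proj₁
           (trans (lookup-index (found i)) (trans (cong (List.lookup L) same) (sym (lookup-index (found j)))))))
      where
      found : ∀ i → (𝓔.p (w i) , 𝓔.a (w i)) ∈ₗ L
      found i = complete (w i) _ ((𝓔.p⊨P (w i) , ≈ᴱ-refl (w i)) , divides i) (covers i)

  nonprincipal⇒nonstandard : (P : P̄) → ¬ Principal P → ∀ {p} → p ⊨ ultrafilter P → ∀ n → p ≢ ι n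
  nonprincipal⇒nonstandard P ¬principal p⊨P n refl =
    ¬principal (n , λ A → trans (sym (p⊨P A)) (T-≡ (to (tp-ι n A)) (from (tp-ι n A))))

  module FirstKindClass {P : P̄} (u : 𝓔 P) (fk : ∀ p → p ⊨ ultrafilter P → ∃! _≡_ λ a → (p , a) ∈ᴱ u) where

    exponent-unique : ∀ {p a b} → (p , a) ∈ᴱ u → (p , b) ∈ᴱ u → a ≡ b
    exponent-unique {p} ma@(p⊨P , _) mb = let _ , _ , unique = fk p p⊨P in trans (sym (unique ma)) (unique mb)

    generator-prime : ∀ {p} → p ⊨ ultrafilter P → T (tp p ℙ)
    generator-prime p⊨P = subst T (sym (p⊨P ℙ)) (P̄.ℙ-∈ P)

    -- Without a separating set pᵃ⁺¹ would be equivalent to pᵃ, so that a + 1 would be a second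
    -- exponent for p in `u`.
    separating : ∀ {p a c} → (p , a) ∈ᴱ u → sucR* a c → ∃ λ A → T (tp^ p c A) × 𝒰 A × ¬ T (tp^ p a A)
    separating {p} {a} {c} ma@(p⊨P , m) s = ∣̃-separate λ h →
      <⇒≢ a c (suc⇒< a c s) (exponent-unique ma
        (p⊨P , ⇒≈ᴱ ⟨ p , p⊨P , c ⟩ u
                 (=∼-trans (h , tp^-mono (<⇒≤ a c (suc⇒< a c s))) (≈ᴱ⇒ ⟨ p , p⊨P , a ⟩ u m))))

    -- First a < b, as otherwise v would be equivalent to u. If b were not a + 1, the class of pᵃ⁺¹
    -- would lie strictly between u and v.
    successor-exponent : ∀ {v p a b c} → ImmediateSuccessor u v → (p , a) ∈ᴱ u → (p , b) ∈ᴱ v → sucR* a c → c ≡ b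
    successor-exponent {v} {p} {a} {b} {c} ((u≉v , p′ , a′ , b′ , _ , a′<b′ , (p′⊨P , m′) , (p′⊨P′ , n′)) , none)
                       ma@(p⊨P , m) (p⊨P′ , n) s with lem {c ≡ b}
    ... | yes c≡b = c≡b
    ... | no  c≢b = ⊥-elim (none w (u≺w , w≺v))
      where
      w : 𝓔 P
      w = ⟨ p , p⊨P , c ⟩
      p^b≈v : tp^ p b =∼ tpᴱ v
      p^b≈v = ≈ᴱ⇒ ⟨ p , p⊨P′ , b ⟩ v n
      p^a≈u : tp^ p a =∼ tpᴱ u
      p^a≈u = ≈ᴱ⇒ ⟨ p , p⊨P , a ⟩ u m
      u∣v : tpᴱ u ∣̃ tpᴱ v
      u∣v = ∣̃-trans (proj₂ (≈ᴱ⇒ ⟨ p′ , p′⊨P , a′ ⟩ u m′))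
              (∣̃-trans (tp^-mono (<⇒≤ a′ b′ a′<b′)) (proj₁ (≈ᴱ⇒ ⟨ p′ , p′⊨P′ , b′ ⟩ v n′)))
      a<b : a <* b
      a<b with lem {a <* b}
      ... | yes a<b = a<b
      ... | no  a≮b = ⊥-elim (u≉v (⇒≈ᴱ u v
              (u∣v , ∣̃-trans (proj₂ p^b≈v) (∣̃-trans (tp^-mono (≮⇒≥ a b a≮b)) (proj₁ p^a≈u)))))
      a<c : a <* c
      a<c = suc⇒< a c s
      c<b : c <* b
      c<b = ≤∧≢⇒< c b (suc-≤ a c b s a<b) c≢b
      u≺w : u ≺ w
      u≺w = (λ e → <⇒≢ a c a<c (exponent-unique ma (p⊨P , ≈ᴱ-sym u w e))) ,
            p , a , c , p⊨P , a<c , ma , (p⊨P , ≈ᴱ-refl w)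
      w≺v : w ≺ v
      w≺v = (λ e → w≉v (=∼-trans (≈ᴱ⇒ w v e) (=∼-sym p^b≈v))) ,
            p , c , b , p⊨P , c<b , (p⊨P , ≈ᴱ-refl w) , (p⊨P′ , n)
        where
        -- The proper multiples of a set that separates pᶜ from pᵃ separate pᵇ from pᶜ.
        w≉v : ¬ (tp^ p c =∼ tp^ p b)
        w≉v (_ , b∣c) = let A , Ac , UA , ¬Aa = separating ma s in
          ¬Aa (proper-multiples-pred UA (generator-prime p⊨P) s (proj₂ (pow-total p a)) (proj₂ (pow-total p c))
            (b∣c _ (proper-multiples-pow (generator-prime p⊨P) (proj₂ (pow-total p c)) Ac c<b
                   (proj₂ (pow-total p b)))
                 (proper-multiples-𝒰 {A} UA)))

    module _ {p a A} (ma : (p , a) ∈ᴱ u) (UA : 𝒰 A) (¬Aa : ¬ T (tp^ p a A)) where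

      -- Let d be the exponent of q in u, which the first kind provides. If e < d, then qᵉ⁺¹ divides
      -- qᵈ and puts it into the extension of `A`; pᵃ, being equivalent to qᵈ, would follow, against
      -- `¬Aa`. So d ≤ e.
      Below⇒≽ : ∀ {x q} → (q⊨P : q ⊨ ultrafilter P) → *Rel (belowR UA) (x ∷ q ∷ []) →
        ∃ λ e → u ≼ ⟨ q , q⊨P , e ⟩ × ExactlyDivides q e x
      Below⇒≽ {x} {q} q⊨P below* = compare (Below*-exact UA x q below*) (fk q q⊨P)
        where
        compare : (∃ λ e → ExactlyDivides q e x × (∀ f z → sucR* e f → q ^ f ≐* z → T (tp z A))) →
                  (∃! _≡_ λ d → (q , d) ∈ᴱ u) → ∃ λ e → u ≼ ⟨ q , q⊨P , e ⟩ × ExactlyDivides q e x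
        compare (e , divides , next) (d , (q⊨P′ , m) , _) = e , u≼w , divides
          where
          w : 𝓔 P
          w = ⟨ q , q⊨P , e ⟩
          e≮d : ¬ (e <* d)
          e≮d e<d = let f , s = suc-total e in
            ¬Aa (proj₂ (≈ᴱ⇒ ⟨ p , proj₁ ma , a ⟩ u (proj₂ ma)) A
              (proj₁ (≈ᴱ⇒ ⟨ q , q⊨P′ , d ⟩ u m) A
                (tp^-mono (suc-≤ e f d s e<d) A (next f _ s (proj₂ (pow-total q f))) UA) UA) UA)
          u≼w : u ≼ w
          u≼w with lem {u ≈ᴱ w}
          ... | yes u≈w = inj₂ u≈w
          ... | no  u≉w = inj₁ (u≉w , q , d , e , q⊨P ,
                  ≤∧≢⇒< d e (≮⇒≥ e d e≮d) (λ { refl → u≉w (≈ᴱ-sym w u m) }) ,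
                  (q⊨P′ , m) , (q⊨P , ≈ᴱ-refl w))

      open Layers A (𝒰-up UA)

      -- `chain` turns failure for every C into K + 1 distinct generators, and `Below⇒≽` places
      -- their exact powers where the sum counts them.
      small-layer : 𝔠⁺-Saturated 𝔑 → ∀ {x} (f : 𝓔 P → ℕ∞) → (∀ w → HasCardinality (Fibre x w) (f w)) →
        ∀ K → IsSum _≈ᴱ_ (u ≼_) f [ K ] →
        ∃ λ C → T (family (ultrafilter P) C) × T (tp x ⟦ (λ n → count (layer C n) (value n) ℕ.≤ K) ⟧)
      small-layer sat {x} f card K sum with lem {∃ λ C → T (family (ultrafilter P) C) ×
                                                T (tp x ⟦ (λ n → count (layer C n) (value n) ℕ.≤ K) ⟧)}
      ... | yes small = small
      ... | no ¬small = ⊥-elim (contradict (suc-total x))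
        where
        contradict : ∃ (sucR* x) → ⊥
        contradict (b , s) = refute (chain UA sat (ultrafilter P) (suc K) x b
            (λ C PC → count* UA C K x b s (λ small → ¬small (C , PC , small))))
          where
          refute : (∃ λ (qs : Vector *ℕ (suc K)) →
                      (∀ i → qs i ⊨ ultrafilter P × *Rel (belowR UA) (x ∷ qs i ∷ []) × qs i <* b) ×
                      (∀ i j → qs i ≡ qs j → i ≡ j)) → ⊥
          refute (qs , props , injective) = sum-bound (u ≼_) f card K sum
            (λ i → ⟨ qs i , proj₁ (props i) , proj₁ (found i) ⟩)
            (λ i → proj₁ (proj₂ (found i))) (λ i → proj₂ (proj₂ (found i))) injective
            where
            found : ∀ i → ∃ λ e → u ≼ ⟨ qs i , proj₁ (props i) , e ⟩ × ExactlyDivides (qs i) e x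
            found i = Below⇒≽ (proj₁ (props i)) (proj₁ (proj₂ (props i)))

theorem5p9 : (lem : ExcludedMiddle 0ℓ) → Extensionality 0ℓ 0ℓ →
    (𝔑 : NonstandardExtension) → 𝔠⁺-Saturated 𝔑 → IsomorphismProperty 𝔑 →
    let open Nonstandard lem 𝔑 in
    (F : βℕ) (α : 𝓑 → ℕ∞) → IsPattern F α →
    (∃ λ (P : P̄) → ∃ λ (u : 𝓔 P) →
    FirstKind u ×
    (∃ λ u+1 → ImmediateSuccessor u u+1 × [ 0 ] <∞ α (P , u+1)) ×
    (∃ λ s → IsSum _≈ᴱ_ (u ≼_) (λ w → α (P , w)) s × s <∞ ⊤⁺)) →
    HasImmediatePredecessor F
theorem5p9 lem ext 𝔑 sat _ F α (x , x⊨F , pattern-x)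
  (P , u , (¬principal , fk) , (v , succ , α>0) , (.([ K ]) , sum , Strict.[ K ]<⊤⁺)) =
  -- An infinite value of α yields an element only in the presence of a nonstandard number; the
  -- prime that represents u is one, because `P` is nonprincipal.
  conclude (inhabited (𝓔.p u , nonprincipal⇒nonstandard P ¬principal (𝓔.p⊨P u)) (pattern-x (P , v)) α>0)
  where
  open Nonstandard lem 𝔑
  open Extension lem ext 𝔑
  open Standard lem
  open Arithmetic lem ext 𝔑
  open BasicClasses lem ext 𝔑
  open FirstKindClass u fk

  conclude : ∃ (Fibre x v) → HasImmediatePredecessor F
  conclude ((p , b) , mb@(p⊨P , _) , (y , x′ , p^b , yx′ , p∤x′)) = drop (fk p p⊨P)
    where
    drop : (∃! _≡_ λ a → (p , a) ∈ᴱ u) → HasImmediatePredecessor F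
    drop (a , ma , _) = step (suc-total a)
      where
      step : (∃ λ c → sucR* a c) → HasImmediatePredecessor F
      step (c , s) = separate (separating ma s)
        where
        p^c : p ^ c ≐* y
        p^c = subst (λ e → p ^ e ≐* y) (sym (successor-exponent {v = v} succ ma mb s)) p^b
        separate : (∃ λ A → T (tp^ p c A) × 𝒰 A × ¬ T (tp^ p a A)) → HasImmediatePredecessor F
        separate (A , Ac , UA , ¬Aa) =
          finish (small-layer ma UA ¬Aa sat (λ w → α (P , w)) (λ w → pattern-x (P , w)) K sum)
          where
          open Layers A (𝒰-up UA)
          finish : (∃ λ C → T (family (ultrafilter P) C) ×
                            T (tp x ⟦ (λ n → count (layer C n) (value n) ℕ.≤ K) ⟧)) → HasImmediatePredecessor F
          -- Both conditions are standard sets with x in their extensions, and x generates `F`, so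
          -- both sets belong to `F`.
          finish (C , PC , small) = predecessor C ext F K (subst T (x⊨F _) small) (subst T (x⊨F _)
            (Drops* UA (generator-prime p⊨P) (subst T (sym (p⊨P C)) PC) s (proj₂ (pow-total p a)) p^c yx′ p∤x′
              ¬Aa (subst (λ X → T (X A)) (tp^-≡ p^c) Ac)))
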